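{- Let $f_{n,k}=|\Pi_{n,k}/\sim_{ne}|$ for $n\ge k\ge1$. Then $f_{n,1}=1$, and for $k\ge2$, $$f_{n,k}=\sum_{r=k-1}^{n-1}f_{r,k-1}+(k-1)\binom{n-2}{k}.$$
   Context: $\Pi_{n,k}$ is the set of partitions of $[n]$ with $k$ blocks. Partitions are drawn with arcs joining consecutive elements of each block; $ne(\mu)$ is the number of pairs of arcs $(i_1,j_1),(i_2,j_2)$ with $i_1<i_2<j_2<j_1$. The tree of partitions has root the empty partition, and a partition $\mu$ of $[N+1]$ is a child of a partition $\nu$ of $[N]$ iff the restriction of $\mu$ to $\{2,\dots,N+1\}$ is order-isomorphic to $\nu$; $\mathcal{T}(\lambda,l,m)$ is the set of descendants of $\lambda$ at distance $l$ (partitions of $[n+l]$ whose restriction to the last $n$ elements is order-isomorphic to $\lambda\in\Pi_n$) having $m$ blocks. For $\lambda,\pi\in\Pi_n$, $\lambda\sim_{ne}\pi$ iff the multisets $\{ne(\mu):\mu\in\mathcal{T}(\lambda,l,m)\}$ and $\{ne(\mu):\mu\in\mathcal{T}(\pi,l,m)\}$ coincide for all $l,m\ge0$. $\Pi_{n,k}/\sim_{ne}$ is the set of equivalence classes of $\sim_{ne}$ restricted to $\Pi_{n,k}$. -}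

module Defs where

open import Data.Bool using (Bool; true; false; if_then_else_; _∧_)
open import Data.Nat using (ℕ; zero; suc; _+_; _*_; _∸_; _⊔_; _≡ᵇ_; _<ᵇ_)
open import Data.Nat.Combinatorics using (_C_)
open import Data.Maybe using (Maybe; just; nothing)
open import Data.Product using (_×_; _,_; Σ; ∃)
open import Data.List using (List; []; _∷_; map; concatMap; upTo; applyUpTo; filterᵇ;
  length; drop; cartesianProduct; _++_; zip)
open import Data.Nat.ListAction using (sum)
open import Data.List.Relation.Binary.Permutation.Propositional using (_↭_)
open import Data.List.Relation.Unary.All using (All)
open import Data.List.Relation.Unary.Any using (Any)
open import Data.List.Relation.Unary.AllPairs using (AllPairs)
open import Data.List.Membership.Propositional using (_∈_)
open import Relation.Nullary using (¬_)
open import Relation.Binary.PropositionalEquality using (_≡_)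

-- Set partitions of [n] are encoded by restricted growth strings (RGS):
-- a list of length n whose i-th entry is the index (0-based, in order of
-- first appearance) of the block containing element i+1.

-- extend n b : all RGS-suffixes of length n when b blocks are already open.
extend : ℕ → ℕ → List (List ℕ)
extend zero    b = [] ∷ []
extend (suc n) b =
  concatMap (λ c → map (c ∷_) (extend n (if c ≡ᵇ b then suc b else b))) (upTo (suc b))

Partitions : ℕ → List (List ℕ)
Partitions n = extend n 0

blocks : List ℕ → ℕ
blocks = Data.List.foldr (λ x acc → suc x ⊔ acc) 0

Partitions' : ℕ → ℕ → List (List ℕ)
Partitions' n k = filterᵇ (λ μ → blocks μ ≡ᵇ k) (Partitions n)

-- standardization: relabel blocks in order of first appearance
-- (gives the RGS of the order-isomorphic partition of a restriction)
indexOf : ℕ → List ℕ → Maybe ℕ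
indexOf x []       = nothing
indexOf x (y ∷ ys) with x ≡ᵇ y
... | true  = just 0
... | false with indexOf x ys
...   | just i  = just (suc i)
...   | nothing = nothing

stdAux : List ℕ → List ℕ → List ℕ
stdAux seen []       = []
stdAux seen (x ∷ xs) with indexOf x seen
... | just i  = i ∷ stdAux seen xs
... | nothing = length seen ∷ stdAux (seen ++ (x ∷ [])) xs

std : List ℕ → List ℕ
std = stdAux []

listEqᵇ : List ℕ → List ℕ → Bool
listEqᵇ []       []       = true
listEqᵇ (x ∷ xs) (y ∷ ys) = (x ≡ᵇ y) ∧ listEqᵇ xs ys
listEqᵇ _        _        = false

-- 𝒯(λ,l,m): partitions μ of [n+l] with m blocks whose restriction to the
-- last n elements is order-isomorphic to λ (n = length λ)
Desc : List ℕ → ℕ → ℕ → List (List ℕ)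
Desc lam l m =
  filterᵇ (λ μ → listEqᵇ (std (drop l μ)) lam ∧ (blocks μ ≡ᵇ m))
          (Partitions (length lam + l))

-- arcs: (i , j) with i < j consecutive elements of a block (0-based positions)
nextOcc : ℕ → ℕ → List ℕ → Maybe ℕ
nextOcc a pos []       = nothing
nextOcc a pos (x ∷ xs) = if a ≡ᵇ x then just pos else nextOcc a (suc pos) xs

arcsAux : ℕ → List ℕ → List (ℕ × ℕ)
arcsAux i []       = []
arcsAux i (x ∷ xs) with nextOcc x (suc i) xs
... | just j  = (i , j) ∷ arcsAux (suc i) xs
... | nothing = arcsAux (suc i) xs

arcs : List ℕ → List (ℕ × ℕ)
arcs = arcsAux 0

nested : (ℕ × ℕ) × (ℕ × ℕ) → Bool
nested ((i₁ , j₁) , (i₂ , j₂)) = (i₁ <ᵇ i₂) ∧ (i₂ <ᵇ j₂) ∧ (j₂ <ᵇ j₁)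

ne : List ℕ → ℕ
ne μ = length (filterᵇ nested (cartesianProduct (arcs μ) (arcs μ)))

_∼ne_ : List ℕ → List ℕ → Set
lam ∼ne pi = ∀ l m → map ne (Desc lam l m) ↭ map ne (Desc pi l m)

ClassCount : ℕ → ℕ → ℕ → Set
ClassCount n k c =
  Σ (List (List ℕ)) λ reps →
    (length reps ≡ c)
    × All (_∈ Partitions' n k) reps
    × AllPairs (λ a b → ¬ (a ∼ne b)) reps
    × (∀ μ → μ ∈ Partitions' n k → Any (μ ∼ne_) reps)

sumFromTo : ℕ → ℕ → (ℕ → ℕ) → ℕ
sumFromTo a b g = sum (map g (applyUpTo (a +_) (suc b ∸ a)))

{-# OPTIONS --safe #-}
module Submission where

-- Build a partition from right to left. Joining a new first element to the
-- block with minimum b creates one arc, which encloses exactly the arcs ending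
-- before b, and those correspond to the non-minima before b. So the whole
-- subtree of λ depends only on ne λ and on the set of block minima. Conversely
-- l = 0 recovers ne λ, and l = 1 with the same number of blocks recovers the
-- multiset of the numbers of non-minima before each minimum, hence the minima.
--
-- It remains to count the pairs (minima, ne). For given minima, the arc ending
-- at a non-minimum p is enclosed by at most min(h - 1, r) arcs, where h is the
-- number of blocks opened before p and r the number of later non-minima; the
-- sum of these bounds and every smaller value is attained. Appending a
-- non-minimum to a word with k minima raises the sum by the number of
-- non-minima among its last k - 1 letters, which gives the recurrence
-- f(n+1,k) = f(n,k) + f(n,k-1) + (k-1) C(n-2,k-1).

open import Defs
open import Algebra.Properties.CommutativeSemigroup using (interchange)
open import Data.Bool using (Bool; true; false; if_then_else_; _∧_; _∨_; T)
open import Data.Bool.Properties using (∨-assoc; ∨-comm; ∨-idem; ∨-identityʳ; ∨-zeroʳ)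
open import Data.Empty using (⊥-elim)
open import Data.List using (List; []; _∷_; _++_; map; concat; concatMap; filterᵇ; length; cartesianProduct; upTo; applyUpTo; drop; take)
open import Data.List.Properties using (map-cong; map-cong-local; map-∘; map-++; map-injective; filter-++; length-++; length-map; length-filter; length-upTo; ++-assoc; ++-identityʳ; upTo-∷ʳ; applyUpTo-∷ʳ; ∷-injectiveˡ; ∷-injectiveʳ)
open import Data.List.Membership.Propositional using (_∈_; find; lose)
open import Data.List.Membership.Propositional.Properties using (∈-∃++; ∈-upTo⁺; ∈-upTo⁻; ∈-map⁺; ∈-map⁻; ∈-++⁺ˡ; ∈-++⁺ʳ; ∈-++⁻; ∈-concatMap⁺; ∈-concatMap⁻; ∈-filter⁺; ∈-filter⁻)
open import Data.List.Relation.Binary.Permutation.Propositional using (_↭_; ↭⇒↭ₛ; ↭-refl; ↭-sym; ↭-trans; ↭-reflexive)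
open import Data.List.Relation.Binary.Permutation.Propositional.Properties using (∈-resp-↭; ↭-length; ++⁺ˡ; ++⁺ʳ; ∷↭∷ʳ; ↭-singleton-inv)
import Data.List.Relation.Binary.Permutation.Setoid.Properties as PermutationSetoid
open import Data.List.Relation.Binary.Pointwise as Pointwise using (Pointwise; []; _∷_)
open import Data.List.Relation.Unary.All as All using (All; []; _∷_)
import Data.List.Relation.Unary.All.Properties as All
open import Data.List.Relation.Unary.AllPairs as AllPairs using (AllPairs; []; _∷_)
import Data.List.Relation.Unary.AllPairs.Properties as AllPairs
open import Data.List.Relation.Unary.Any using (Any; here; there)
open import Data.List.Relation.Unary.Linked.Properties using (AllPairs⇒Linked)
open import Data.List.Relation.Unary.Sorted.TotalOrder.Properties using (↗↭↗⇒≋)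
open import Data.List.Relation.Unary.Unique.Propositional using (Unique)
import Data.List.Relation.Unary.Unique.Propositional.Properties as Unique
open import Data.Maybe as Maybe using (Maybe; just; nothing; is-just; maybe′)
open import Data.Maybe.Properties using (just-injective)
open import Data.Nat using (ℕ; zero; suc; _+_; _*_; _∸_; _⊔_; _⊓_; _≤_; _<_; z≤n; s≤s; _≡ᵇ_; _<ᵇ_; _≟_; _≤?_)
open import Data.Nat.Combinatorics using (_C_; nCk+nC[k+1]≡[n+1]C[k+1]; k>n⇒nCk≡0)
open import Data.Nat.ListAction using (sum)
open import Data.Nat.ListAction.Properties using (sum-++)
open import Data.Nat.Properties hiding (_≟_; _≤?_)
open import Data.Nat.Solver using (module +-*-Solver)
open import Data.Product using (Σ; ∃; ∃₂; _×_; _,_; proj₁; proj₂)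
open import Data.Sum using (inj₁; inj₂)
open import Function using (_∘_; id)
open import Relation.Binary.PropositionalEquality
open import Relation.Nullary using (¬_; yes; no)
open import Relation.Nullary.Decidable using (T?)

-- Nestings computed from right to left

-- For equal minima the two subtrees agree entry by entry: a prefix fixes the open labels, a suffix
-- fitting either pattern is free only in the labels of the blocks it opens, and these open at the
-- same places. So one direction is an equality of lists; only the converse has to argue with
-- multisets.
--
-- The count meets an obstacle: `nestings` peels letters off the front, while the attainable values
-- are visible only when blocks are continued from left to right. The bridge is a word `T ++ μ` in
-- which the whole past is replaced by one letter per open block, ordered by latest element.
-- Continuing a block moves its letter to the end of `T`, and the older blocks that are still to be
-- continued are the arcs enclosing the new one.
--
-- Why only the last k - 1 letters matter: appending a non-minimum raises min(h - 1, r) to min(h -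
-- 1, r + 1), a change exactly when r + 1 ≤ h - 1. Of the k minima, k - h come after the non-minimum
-- in question, so its place from the end is (k - h) + r + 1, and the condition says that this is at
-- most k - 1.

≡ᵇ-refl : ∀ n → (n ≡ᵇ n) ≡ true
≡ᵇ-refl zero    = refl
≡ᵇ-refl (suc n) = ≡ᵇ-refl n

≢⇒≡ᵇ-false : ∀ {m n} → m ≢ n → (m ≡ᵇ n) ≡ false
≢⇒≡ᵇ-false {zero}  {zero}  m≢n = ⊥-elim (m≢n refl)
≢⇒≡ᵇ-false {zero}  {suc n} m≢n = refl
≢⇒≡ᵇ-false {suc m} {zero}  m≢n = refl
≢⇒≡ᵇ-false {suc m} {suc n} m≢n = ≢⇒≡ᵇ-false (m≢n ∘ cong suc)

≡ᵇ-true⇒≡ : ∀ m n → (m ≡ᵇ n) ≡ true → m ≡ n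
≡ᵇ-true⇒≡ m n eq = ≡ᵇ⇒≡ m n (subst T (sym eq) _)

<ᵇ-true : ∀ {m n} → m < n → (m <ᵇ n) ≡ true
<ᵇ-true {zero}  {suc n} _       = refl
<ᵇ-true {suc m} {suc n} (s≤s p) = <ᵇ-true p

<ᵇ-false : ∀ {m n} → n ≤ m → (m <ᵇ n) ≡ false
<ᵇ-false z≤n     = refl
<ᵇ-false (s≤s p) = <ᵇ-false p

ind : Bool → ℕ
ind b = if b then 1 else 0

filterᵇ-map : ∀ {A B : Set} (p : B → Bool) (f : A → B) xs →
  filterᵇ p (map f xs) ≡ map f (filterᵇ (p ∘ f) xs)
filterᵇ-map p f []       = refl
filterᵇ-map p f (x ∷ xs) with p (f x)
... | true  = cong (f x ∷_) (filterᵇ-map p f xs)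
... | false = filterᵇ-map p f xs

filterᵇ-cong : ∀ {A : Set} {p q : A → Bool} → (∀ x → p x ≡ q x) → ∀ xs →
  filterᵇ p xs ≡ filterᵇ q xs
filterᵇ-cong         p≗q []       = refl
filterᵇ-cong {p = p} {q} p≗q (x ∷ xs) with p x | q x | p≗q x
... | true  | .true  | refl = cong (x ∷_) (filterᵇ-cong p≗q xs)
... | false | .false | refl = filterᵇ-cong p≗q xs

filterᵇ-∧ : ∀ {A : Set} (p q : A → Bool) xs →
  filterᵇ (λ x → p x ∧ q x) xs ≡ filterᵇ q (filterᵇ p xs)
filterᵇ-∧ p q []       = refl
filterᵇ-∧ p q (x ∷ xs) with p x
... | false = filterᵇ-∧ p q xs
... | true with q x
...   | true  = cong (x ∷_) (filterᵇ-∧ p q xs)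
...   | false = filterᵇ-∧ p q xs

filterᵇ-false : ∀ {A : Set} (xs : List A) → filterᵇ (λ _ → false) xs ≡ []
filterᵇ-false []       = refl
filterᵇ-false (x ∷ xs) = filterᵇ-false xs

filterᵇ-++ : ∀ {A : Set} (p : A → Bool) xs ys →
  filterᵇ p (xs ++ ys) ≡ filterᵇ p xs ++ filterᵇ p ys
filterᵇ-++ p = filter-++ (T? ∘ p)

filterᵇ-concatMap : ∀ {A B : Set} (p : B → Bool) (f : A → List B) xs →
  filterᵇ p (concatMap f xs) ≡ concatMap (filterᵇ p ∘ f) xs
filterᵇ-concatMap p f []       = refl
filterᵇ-concatMap p f (x ∷ xs) =
  trans (filterᵇ-++ p (f x) (concatMap f xs))
        (cong (filterᵇ p (f x) ++_) (filterᵇ-concatMap p f xs))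

count : ∀ {A : Set} → (A → Bool) → List A → ℕ
count p xs = length (filterᵇ p xs)

count-∷ : ∀ {A : Set} (p : A → Bool) x xs → count p (x ∷ xs) ≡ ind (p x) + count p xs
count-∷ p x xs with p x
... | true  = refl
... | false = refl

count-++ : ∀ {A : Set} (p : A → Bool) xs ys → count p (xs ++ ys) ≡ count p xs + count p ys
count-++ p xs ys = trans (cong length (filterᵇ-++ p xs ys))
  (length-++ (filterᵇ p xs))

count-map : ∀ {A B : Set} (p : B → Bool) (f : A → B) xs → count p (map f xs) ≡ count (p ∘ f) xs
count-map p f xs = trans (cong length (filterᵇ-map p f xs)) (length-map f (filterᵇ (p ∘ f) xs))

count-cong : ∀ {A : Set} {p q : A → Bool} {xs} → All (λ x → p x ≡ q x) xs → count p xs ≡ count q xs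
count-cong []         = refl
count-cong {p = p} {q} {x ∷ xs} (e ∷ es) =
  trans (count-∷ p x xs) (trans (cong₂ _+_ (cong ind e) (count-cong es)) (sym (count-∷ q x xs)))

-- The word of a partition records each block label at the minimum of the
-- block and nothing elsewhere.
Word : Set
Word = List (Maybe ℕ)

hide₁ : (ℕ → Bool) → Maybe ℕ → Maybe ℕ
hide₁ P nothing  = nothing
hide₁ P (just c) = if P c then nothing else just c

hide : (ℕ → Bool) → Word → Word
hide P = map (hide₁ P)

-- A new `c` in front turns the former minimum of its block into a non-minimum; hence the hiding in
-- the tail.
firsts : List ℕ → Word
firsts []      = []
firsts (c ∷ μ) = just c ∷ hide (c ≡ᵇ_) (firsts μ)

-- a plus the number of non-minima before the minimum of block c; 0 if there
-- is no such block.
before : ℕ → ℕ → Word → ℕ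
before a c []            = 0
before a c (nothing ∷ w) = before (suc a) c w
before a c (just d ∷ w)  = if c ≡ᵇ d then a else before a c w

-- Joining a new first element to the block of c adds one arc, which encloses
-- exactly the arcs ending before the minimum of that block.
nestings : List ℕ → ℕ
nestings []      = 0
nestings (c ∷ μ) = nestings μ + before 0 c (firsts μ)

hide-cong : ∀ {P Q : ℕ → Bool} → (∀ x → P x ≡ Q x) → ∀ w → hide P w ≡ hide Q w
hide-cong P≗Q = map-cong λ where
  nothing  → refl
  (just c) → cong (λ b → if b then nothing else just c) (P≗Q c)

hide-hide : ∀ (P Q : ℕ → Bool) w → hide P (hide Q w) ≡ hide (λ x → P x ∨ Q x) w
hide-hide P Q w = trans (sym (map-∘ w)) (map-cong lem w)
  where
  lem : ∀ x → hide₁ P (hide₁ Q x) ≡ hide₁ (λ x → P x ∨ Q x) x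
  lem nothing = refl
  lem (just c) with Q c
  ... | true  rewrite ∨-zeroʳ (P c) = refl
  ... | false with P c
  ...   | true  = refl
  ...   | false = refl

hide-none : ∀ w → hide (λ _ → false) w ≡ w
hide-none []            = refl
hide-none (nothing ∷ w) = cong (nothing ∷_) (hide-none w)
hide-none (just x ∷ w)  = cong (just x ∷_) (hide-none w)

holes : ℕ → Word → ℕ
holes zero    w             = 0
holes (suc t) []            = 0
holes (suc t) (nothing ∷ w) = suc (holes t w)
holes (suc t) (just _ ∷ w)  = holes t w

Absent : ℕ → Word → Set
Absent c = All (_≢ just c)

-- The occurrence is required to be unique, so that hiding `c` creates exactly one hole.
data At (c : ℕ) : ℕ → Word → Set where
  here  : ∀ {w} → Absent c w → At c 0 (just c ∷ w)
  there : ∀ {t x w} → x ≢ just c → At c t w → At c (suc t) (x ∷ w)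

hide₁-≢ : ∀ {c} P x → x ≢ just c → hide₁ P x ≢ just c
hide₁-≢ P nothing  _   ()
hide₁-≢ P (just d) d≢c eq with P d
... | true with () ← eq
... | false = d≢c eq

Absent-hide : ∀ {c} P {w} → Absent c w → Absent c (hide P w)
Absent-hide P = All.map⁺ ∘ All.map (λ {x} → hide₁-≢ P x)

Absent-hide-self : ∀ c w → Absent c (hide (c ≡ᵇ_) w)
Absent-hide-self c []            = []
Absent-hide-self c (nothing ∷ w) = (λ ()) ∷ Absent-hide-self c w
Absent-hide-self c (just d ∷ w) with c ≟ d
... | yes refl rewrite ≡ᵇ-refl c = (λ ()) ∷ Absent-hide-self c w
... | no c≢d rewrite ≢⇒≡ᵇ-false c≢d =
  (λ e → c≢d (sym (just-injective e))) ∷ Absent-hide-self c w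

At-hide : ∀ {c t} P {w} → P c ≡ false → At c t w → At c t (hide P w)
At-hide P Pc (here ab) rewrite Pc = here (Absent-hide P ab)
At-hide P Pc (there x≢c at) = there (hide₁-≢ P _ x≢c) (At-hide P Pc at)

hide-Absent : ∀ {c w} → Absent c w → hide (c ≡ᵇ_) w ≡ w
hide-Absent [] = refl
hide-Absent {w = nothing ∷ w} (_ ∷ ab) = cong (nothing ∷_) (hide-Absent ab)
hide-Absent {c} {just d ∷ w} (d≢c ∷ ab)
  rewrite ≢⇒≡ᵇ-false {c} {d} (λ e → d≢c (cong just (sym e))) = cong (just d ∷_) (hide-Absent ab)

holes-hide : ∀ {c j w} → At c j w → ∀ t → holes t (hide (c ≡ᵇ_) w) ≡ ind (j <ᵇ t) + holes t w
holes-hide at zero = refl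
holes-hide {c} (here {w} ab) (suc t) rewrite ≡ᵇ-refl c | hide-Absent ab = refl
holes-hide (there {x = nothing} _ at) (suc t) rewrite holes-hide at t = sym (+-suc _ _)
holes-hide {c} (there {x = just d} x≢c at) (suc t)
  rewrite ≢⇒≡ᵇ-false {c} {d} (λ e → x≢c (cong just (sym e))) = holes-hide at t

before-At : ∀ {c t w} → At c t w → ∀ a → before a c w ≡ a + holes t w
before-At {c} (here _) a rewrite ≡ᵇ-refl c = sym (+-identityʳ a)
before-At (there {x = nothing} _ at) a = trans (before-At at (suc a)) (sym (+-suc a _))
before-At {c} (there {x = just d} x≢c at) a
  rewrite ≢⇒≡ᵇ-false {c} {d} (λ e → x≢c (cong just (sym e))) = before-At at a

before-Absent : ∀ {c w} → Absent c w → ∀ a → before a c w ≡ 0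
before-Absent [] a = refl
before-Absent {w = nothing ∷ w} (_ ∷ ab) a = before-Absent ab (suc a)
before-Absent {c} {just d ∷ w} (d≢c ∷ ab) a
  rewrite ≢⇒≡ᵇ-false {c} {d} (λ e → d≢c (cong just (sym e))) = before-Absent ab a

-- The next element of the block is its minimum within `μ`, so the arc from a new `c` ends where the
-- word shows `just c`.
nextOcc-just : ∀ c q μ {j} → nextOcc c q μ ≡ just j → ∃ λ t → j ≡ q + t × At c t (firsts μ)
nextOcc-just c q (x ∷ μ) eq with c ≟ x
... | yes refl rewrite ≡ᵇ-refl c with refl ← eq =
  0 , sym (+-identityʳ q) , here (Absent-hide-self c (firsts μ))
... | no c≢x rewrite ≢⇒≡ᵇ-false c≢x with t , e , at ← nextOcc-just c (suc q) μ eq =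
  suc t , trans e (sym (+-suc q t)) ,
  there (λ { refl → c≢x refl }) (At-hide (x ≡ᵇ_) (≢⇒≡ᵇ-false (c≢x ∘ sym)) at)

nextOcc-nothing : ∀ c q μ → nextOcc c q μ ≡ nothing → Absent c (firsts μ)
nextOcc-nothing c q []      eq = []
nextOcc-nothing c q (x ∷ μ) eq with c ≟ x
... | yes refl rewrite ≡ᵇ-refl c with () ← eq
... | no c≢x rewrite ≢⇒≡ᵇ-false c≢x =
  (λ { refl → c≢x refl }) ∷ Absent-hide (x ≡ᵇ_) (nextOcc-nothing c (suc q) μ eq)

Arc≥ : ℕ → ℕ × ℕ → Set
Arc≥ q (i , j) = q ≤ i × i < j

Arc≥-pred : ∀ {q a} → Arc≥ (suc q) a → Arc≥ q a
Arc≥-pred (q≤i , i<j) = <⇒≤ q≤i , i<j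

arcsAux-≥ : ∀ q μ → All (Arc≥ q) (arcsAux q μ)
arcsAux-≥ q []      = []
arcsAux-≥ q (x ∷ μ) with nextOcc x (suc q) μ in eq
... | nothing = All.map Arc≥-pred (arcsAux-≥ (suc q) μ)
... | just j with t , refl , _ ← nextOcc-just x (suc q) μ eq =
  (≤-refl , s≤s (m≤m+n q t)) ∷ All.map Arc≥-pred (arcsAux-≥ (suc q) μ)

-- Each non-minimum is the right end of exactly one arc and no minimum is one, so arcs are counted
-- by right ends alone.
arcs-ending-before : ∀ t q μ → count (λ a → proj₂ a <ᵇ q + t) (arcsAux q μ) ≡ holes t (firsts μ)
arcs-ending-before zero q μ =
  trans (count-cong (All.map (λ { {i , j} (q≤i , i<j) →
          <ᵇ-false (≤-trans (≤-reflexive (+-identityʳ q)) (≤-trans q≤i (<⇒≤ i<j))) }) (arcsAux-≥ q μ)))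
        (cong length (filterᵇ-false (arcsAux q μ)))
arcs-ending-before (suc t) q []      = refl
arcs-ending-before (suc t) q (x ∷ μ) with nextOcc x (suc q) μ in eq
... | nothing rewrite hide-Absent (nextOcc-nothing x (suc q) μ eq) | +-suc q t =
  arcs-ending-before t (suc q) μ
... | just j with j' , refl , at ← nextOcc-just x (suc q) μ eq = begin
  count (λ a → proj₂ a <ᵇ q + suc t) ((q , suc q + j') ∷ arcsAux (suc q) μ)
    ≡⟨ cong (λ z → count (λ a → proj₂ a <ᵇ z) ((q , suc q + j') ∷ arcsAux (suc q) μ)) (+-suc q t) ⟩
  count (λ a → proj₂ a <ᵇ suc q + t) ((q , suc q + j') ∷ arcsAux (suc q) μ)
    ≡⟨ count-∷ (λ a → proj₂ a <ᵇ suc q + t) (q , suc q + j') (arcsAux (suc q) μ) ⟩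
  ind (suc q + j' <ᵇ suc q + t) + count (λ a → proj₂ a <ᵇ suc q + t) (arcsAux (suc q) μ)
    ≡⟨ cong₂ _+_ (cong ind (<ᵇ-+ (suc q))) (arcs-ending-before t (suc q) μ) ⟩
  ind (j' <ᵇ t) + holes t (firsts μ)
    ≡⟨ holes-hide at t ⟨
  holes t (hide (x ≡ᵇ_) (firsts μ)) ∎
  where
  open ≡-Reasoning
  <ᵇ-+ : ∀ a {m n} → (a + m <ᵇ a + n) ≡ (m <ᵇ n)
  <ᵇ-+ zero    = refl
  <ᵇ-+ (suc a) = <ᵇ-+ a

-- Nested pairs of arcs when a leftmost arc is added

nested-pairs : List (ℕ × ℕ) → ℕ
nested-pairs A = count nested (cartesianProduct A A)

nested-outside : ∀ {q j} A B → All (Arc≥ (suc q)) A →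
  count nested (cartesianProduct A ((q , j) ∷ B)) ≡ count nested (cartesianProduct A B)
nested-outside [] B _ = refl
nested-outside {q} {j} ((i , k) ∷ A) B ((q<i , _) ∷ ps) = begin
  count nested (map ((i , k) ,_) ((q , j) ∷ B) ++ cartesianProduct A ((q , j) ∷ B))
    ≡⟨ count-++ nested (map ((i , k) ,_) ((q , j) ∷ B)) _ ⟩
  count nested (((i , k) , (q , j)) ∷ map ((i , k) ,_) B) + count nested (cartesianProduct A ((q , j) ∷ B))
    ≡⟨ cong₂ _+_ (count-∷ nested ((i , k) , (q , j)) (map ((i , k) ,_) B)) (nested-outside A B ps) ⟩
  ind ((i <ᵇ q) ∧ (q <ᵇ j) ∧ (j <ᵇ k)) + count nested (map ((i , k) ,_) B) + count nested (cartesianProduct A B)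
    ≡⟨ cong (λ b → ind (b ∧ (q <ᵇ j) ∧ (j <ᵇ k)) + count nested (map ((i , k) ,_) B) + count nested (cartesianProduct A B))
         (<ᵇ-false (<⇒≤ q<i)) ⟩
  count nested (map ((i , k) ,_) B) + count nested (cartesianProduct A B)
    ≡⟨ count-++ nested (map ((i , k) ,_) B) _ ⟨
  count nested (cartesianProduct ((i , k) ∷ A) B) ∎
  where open ≡-Reasoning

-- An arc starting left of all others is never the inner one, and as the outer one it is limited
-- only by its right end.
nested-pairs-∷ : ∀ {q j} A → All (Arc≥ (suc q)) A →
  nested-pairs ((q , j) ∷ A) ≡ nested-pairs A + count (λ a → proj₂ a <ᵇ j) A
nested-pairs-∷ {q} {j} A ps = begin
  nested-pairs ((q , j) ∷ A)
    ≡⟨ count-++ nested (map ((q , j) ,_) ((q , j) ∷ A)) _ ⟩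
  count nested (map ((q , j) ,_) ((q , j) ∷ A)) + count nested (cartesianProduct A ((q , j) ∷ A))
    ≡⟨ cong₂ _+_ (count-map nested ((q , j) ,_) ((q , j) ∷ A)) (nested-outside A A ps) ⟩
  count (λ a → nested ((q , j) , a)) ((q , j) ∷ A) + nested-pairs A
    ≡⟨ cong (_+ nested-pairs A) (count-∷ (λ a → nested ((q , j) , a)) (q , j) A) ⟩
  ind ((q <ᵇ q) ∧ (q <ᵇ j) ∧ (j <ᵇ j)) + count (λ a → nested ((q , j) , a)) A + nested-pairs A
    ≡⟨ cong (λ b → ind (b ∧ (q <ᵇ j) ∧ (j <ᵇ j)) + count (λ a → nested ((q , j) , a)) A + nested-pairs A)
         (<ᵇ-false (≤-refl {q})) ⟩
  count (λ a → nested ((q , j) , a)) A + nested-pairs A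
    ≡⟨ cong (_+ nested-pairs A) (count-cong (All.map
         (λ { {i , k} (q<i , i<k) → cong₂ (λ b b' → b ∧ b' ∧ (k <ᵇ j)) (<ᵇ-true q<i) (<ᵇ-true i<k) }) ps)) ⟩
  count (λ a → proj₂ a <ᵇ j) A + nested-pairs A
    ≡⟨ +-comm _ (nested-pairs A) ⟩
  nested-pairs A + count (λ a → proj₂ a <ᵇ j) A ∎
  where open ≡-Reasoning

nested-pairs-arcsAux : ∀ q μ → nested-pairs (arcsAux q μ) ≡ nestings μ
nested-pairs-arcsAux q []      = refl
nested-pairs-arcsAux q (x ∷ μ) with nextOcc x (suc q) μ in eq
... | nothing = begin
  nested-pairs (arcsAux (suc q) μ)       ≡⟨ nested-pairs-arcsAux (suc q) μ ⟩
  nestings μ                             ≡⟨ +-identityʳ _ ⟨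
  nestings μ + 0                         ≡⟨ cong (nestings μ +_) (before-Absent (nextOcc-nothing x (suc q) μ eq) 0) ⟨
  nestings μ + before 0 x (firsts μ)     ∎
  where open ≡-Reasoning
... | just j with t , refl , at ← nextOcc-just x (suc q) μ eq = begin
  nested-pairs ((q , suc q + t) ∷ arcsAux (suc q) μ)
    ≡⟨ nested-pairs-∷ _ (arcsAux-≥ (suc q) μ) ⟩
  nested-pairs (arcsAux (suc q) μ) + count (λ a → proj₂ a <ᵇ suc q + t) (arcsAux (suc q) μ)
    ≡⟨ cong₂ _+_ (nested-pairs-arcsAux (suc q) μ) (arcs-ending-before t (suc q) μ) ⟩
  nestings μ + holes t (firsts μ)
    ≡⟨ cong (nestings μ +_) (before-At at 0) ⟨
  nestings μ + before 0 x (firsts μ) ∎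
  where open ≡-Reasoning

ne≡nestings : ∀ μ → ne μ ≡ nestings μ
ne≡nestings = nested-pairs-arcsAux 0

-- Descendants of partitions with equal signatures

indexOf-head : ∀ x ys → indexOf x (x ∷ ys) ≡ just 0
indexOf-head x ys rewrite ≡ᵇ-refl x = refl

indexOf-tail : ∀ {x y} ys → x ≢ y → indexOf x (y ∷ ys) ≡ Maybe.map suc (indexOf x ys)
indexOf-tail {x} ys x≢y rewrite ≢⇒≡ᵇ-false x≢y with indexOf x ys
... | just _  = refl
... | nothing = refl

indexOf-++ : ∀ {x i} ys zs → indexOf x ys ≡ just i → indexOf x (ys ++ zs) ≡ just i
indexOf-++ {x} (y ∷ ys) zs eq with x ≟ y
... | yes refl = trans (indexOf-head x _) (trans (sym (indexOf-head x ys)) eq)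
... | no x≢y with indexOf x ys in e | trans (sym (indexOf-tail ys x≢y)) eq
...   | just j | refl = trans (indexOf-tail (ys ++ zs) x≢y) (cong (Maybe.map suc) (indexOf-++ ys zs e))

indexOf-∷ʳ : ∀ x ys → indexOf x ys ≡ nothing → indexOf x (ys ++ x ∷ []) ≡ just (length ys)
indexOf-∷ʳ x []       eq = indexOf-head x []
indexOf-∷ʳ x (y ∷ ys) eq with x ≟ y
... | yes refl with () ← trans (sym (indexOf-head x ys)) eq
... | no x≢y with indexOf x ys in e | trans (sym (indexOf-tail ys x≢y)) eq
...   | nothing | refl = trans (indexOf-tail (ys ++ x ∷ []) x≢y) (cong (Maybe.map suc) (indexOf-∷ʳ x ys e))

indexOf-∷ʳ-≢ : ∀ {x y} ys → x ≢ y → indexOf x ys ≡ nothing → indexOf x (ys ++ y ∷ []) ≡ nothing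
indexOf-∷ʳ-≢ []       x≢y eq = indexOf-tail [] x≢y
indexOf-∷ʳ-≢ {x} {y} (z ∷ ys) x≢y eq with x ≟ z
... | yes refl with () ← trans (sym (indexOf-head x ys)) eq
... | no x≢z with indexOf x ys in e | trans (sym (indexOf-tail ys x≢z)) eq
...   | nothing | refl = trans (indexOf-tail (ys ++ y ∷ []) x≢z) (cong (Maybe.map suc) (indexOf-∷ʳ-≢ ys x≢y e))

indexOf-< : ∀ {x i} ys → indexOf x ys ≡ just i → i < length ys
indexOf-< {x} (y ∷ ys) eq with x ≟ y
... | yes refl with refl ← trans (sym (indexOf-head x ys)) eq = s≤s z≤n
... | no x≢y with indexOf x ys in e | trans (sym (indexOf-tail ys x≢y)) eq
...   | just j | refl = s≤s (indexOf-< ys e)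

indexOf-injective : ∀ {x y i} zs → indexOf x zs ≡ just i → indexOf y zs ≡ just i → x ≡ y
indexOf-injective {x} {y} (z ∷ zs) ex ey with x ≟ z | y ≟ z
... | yes refl | yes refl = refl
... | yes refl | no y≢z with refl ← trans (sym (indexOf-head x zs)) ex
                        with indexOf y zs | trans (sym (indexOf-tail zs y≢z)) ey
...   | just _  | ()
...   | nothing | ()
indexOf-injective {x} {y} (z ∷ zs) ex ey | no x≢z | yes refl
  with refl ← trans (sym (indexOf-head y zs)) ey
  with indexOf x zs | trans (sym (indexOf-tail zs x≢z)) ex
... | just _  | ()
... | nothing | ()
indexOf-injective {x} {y} (z ∷ zs) ex ey | no x≢z | no y≢z
  with indexOf x zs in e | trans (sym (indexOf-tail zs x≢z)) ex
     | indexOf y zs in e' | trans (sym (indexOf-tail zs y≢z)) ey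
... | just _ | refl | just _ | refl = indexOf-injective zs e e'

stdAux-old : ∀ {c i} seen ν → indexOf c seen ≡ just i → stdAux seen (c ∷ ν) ≡ i ∷ stdAux seen ν
stdAux-old seen ν eq rewrite eq = refl

stdAux-new : ∀ {c} seen ν → indexOf c seen ≡ nothing →
  stdAux seen (c ∷ ν) ≡ length seen ∷ stdAux (seen ++ c ∷ []) ν
stdAux-new seen ν eq rewrite eq = refl

-- Labels not listed in L are sent beyond its length, so that the map is
-- injective on all of ℕ.
relabel : List ℕ → ℕ → ℕ
relabel L x = maybe′ id (length L + x) (indexOf x L)

relabel-injective : ∀ L {x y} → relabel L x ≡ relabel L y → x ≡ y
relabel-injective L {x} {y} eq with indexOf x L in ex | indexOf y L in ey
... | just i  | just j  = indexOf-injective L ex (trans ey (cong just (sym eq)))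
... | nothing | nothing = +-cancelˡ-≡ (length L) x y eq
... | just i  | nothing =
  ⊥-elim (<⇒≱ (indexOf-< L ex) (≤-trans (m≤m+n _ y) (≤-reflexive (sym eq))))
... | nothing | just j  =
  ⊥-elim (<⇒≱ (indexOf-< L ey) (≤-trans (m≤m+n _ x) (≤-reflexive eq)))

-- `L` is the final list of seen labels. Labels are only appended at its end, so an index once
-- assigned stays correct and a single map serves all letters.
stdAux-relabel : ∀ seen ν → ∃ λ L →
  (∀ {x i} → indexOf x seen ≡ just i → indexOf x L ≡ just i) × stdAux seen ν ≡ map (relabel L) ν
stdAux-relabel seen []      = seen , id , refl
stdAux-relabel seen (c ∷ ν) with indexOf c seen in eq
... | just i with L , ext , e ← stdAux-relabel seen ν =
  L , ext , cong₂ _∷_ (sym (cong (maybe′ id _) (ext eq))) e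
... | nothing with L , ext , e ← stdAux-relabel (seen ++ c ∷ []) ν =
  L , ext ∘ indexOf-++ seen (c ∷ []) ,
  cong₂ _∷_ (sym (cong (maybe′ id _) (ext (indexOf-∷ʳ c seen eq)))) e

-- Invariance under injective relabelling

module _ (φ : ℕ → ℕ) (φ-injective : ∀ {x y} → φ x ≡ φ y → x ≡ y) where

  ≡ᵇ-map : ∀ x y → (φ x ≡ᵇ φ y) ≡ (x ≡ᵇ y)
  ≡ᵇ-map x y with x ≟ y
  ... | yes refl = trans (≡ᵇ-refl (φ x)) (sym (≡ᵇ-refl x))
  ... | no x≢y   = trans (≢⇒≡ᵇ-false (x≢y ∘ φ-injective)) (sym (≢⇒≡ᵇ-false x≢y))

  hide-map : ∀ c w → hide (φ c ≡ᵇ_) (map (Maybe.map φ) w) ≡ map (Maybe.map φ) (hide (c ≡ᵇ_) w)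
  hide-map c []            = refl
  hide-map c (nothing ∷ w) = cong (nothing ∷_) (hide-map c w)
  hide-map c (just x ∷ w) rewrite ≡ᵇ-map c x with c ≡ᵇ x
  ... | true  = cong (nothing ∷_) (hide-map c w)
  ... | false = cong (just (φ x) ∷_) (hide-map c w)

  firsts-map : ∀ ν → firsts (map φ ν) ≡ map (Maybe.map φ) (firsts ν)
  firsts-map []      = refl
  firsts-map (c ∷ ν) = cong (just (φ c) ∷_)
    (trans (cong (hide (φ c ≡ᵇ_)) (firsts-map ν)) (hide-map c (firsts ν)))

  before-map : ∀ a c w → before a (φ c) (map (Maybe.map φ) w) ≡ before a c w
  before-map a c []            = refl
  before-map a c (nothing ∷ w) = before-map (suc a) c w
  before-map a c (just x ∷ w) rewrite ≡ᵇ-map c x with c ≡ᵇ x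
  ... | true  = refl
  ... | false = before-map a c w

  nestings-map : ∀ ν → nestings (map φ ν) ≡ nestings ν
  nestings-map []      = refl
  nestings-map (c ∷ ν) = cong₂ _+_ (nestings-map ν)
    (trans (cong (before 0 (φ c)) (firsts-map ν)) (before-map 0 c (firsts ν)))

nestings-std : ∀ ν → nestings (std ν) ≡ nestings ν
nestings-std ν with L , _ , e ← stdAux-relabel [] ν =
  trans (cong nestings e) (nestings-map (relabel L) (relabel-injective L) ν)

-- The Boolean list marks the minima; together with `ne` it forms the signature.
data RGS : ℕ → List ℕ → List Bool → Set where
  done : ∀ {b} → RGS b [] []
  old  : ∀ {b c μ w} → c < b → RGS b μ w → RGS b (c ∷ μ) (false ∷ w)
  new  : ∀ {b μ w} → RGS (suc b) μ w → RGS b (b ∷ μ) (true ∷ w)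

RGS-length : ∀ {b μ w} → RGS b μ w → length μ ≡ length w
RGS-length done      = refl
RGS-length (old _ r) = cong suc (RGS-length r)
RGS-length (new r)   = cong suc (RGS-length r)

-- Suffixes with a prescribed standardization

next : ℕ → ℕ → ℕ
next b c = if c ≡ᵇ b then suc b else b

next-old : ∀ {b c} → c < b → next b c ≡ b
next-old c<b rewrite ≢⇒≡ᵇ-false (<⇒≢ c<b) = refl

next-new : ∀ b → next b b ≡ suc b
next-new b rewrite ≡ᵇ-refl b = refl

next-≥ : ∀ b c → b ≤ next b c
next-≥ b c with c ≡ᵇ b
... | true  = n≤1+n b
... | false = ≤-refl

next-> : ∀ {b c} → c < suc b → c < next b c
next-> {b} {c} c≤b with m<1+n⇒m<n∨m≡n c≤b
... | inj₁ c<b  = ≤-trans c<b (next-≥ b c)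
... | inj₂ refl = ≤-reflexive (sym (next-new b))

-- `seen` holds the labels met so far within the suffix, while the `b` open labels also include
-- those of the prefix. Keeping the two apart lets the recursion follow the pattern.
matches : List ℕ → ℕ → ℕ → List ℕ → List (List ℕ)
matches seen n b lam = filterᵇ (λ ν → listEqᵇ (stdAux seen ν) lam) (extend n b)

branch : List ℕ → ℕ → ℕ → ℕ → List ℕ → ℕ → List (List ℕ)
branch seen n b i lam c =
  filterᵇ (λ ν → listEqᵇ (stdAux seen (c ∷ ν)) (i ∷ lam)) (extend n (next b c))

filterᵇ-extend : ∀ (p : List ℕ → Bool) n b → filterᵇ p (extend (suc n) b) ≡
  concatMap (λ c → map (c ∷_) (filterᵇ (p ∘ (c ∷_)) (extend n (next b c)))) (upTo (suc b))
filterᵇ-extend p n b = trans (filterᵇ-concatMap p (λ c → map (c ∷_) (extend n (next b c))) (upTo (suc b)))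
  (cong concat (map-cong (λ c → filterᵇ-map p (c ∷_) (extend n (next b c))) (upTo (suc b))))

matches-∷ : ∀ seen n b i lam → matches seen (suc n) b (i ∷ lam) ≡
  concatMap (λ c → map (c ∷_) (branch seen n b i lam c)) (upTo (suc b))
matches-∷ seen n b i lam = filterᵇ-extend (λ ν → listEqᵇ (stdAux seen ν) (i ∷ lam)) n b

module _ (seen : List ℕ) (n b : ℕ) (lam : List ℕ) where

  branch-head-≢ : ∀ {c i j} → indexOf c seen ≡ just j → j ≢ i → branch seen n b i lam c ≡ []
  branch-head-≢ {c} {i} eq j≢i = trans
    (filterᵇ-cong (λ ν → trans (cong (λ z → listEqᵇ z (i ∷ lam)) (stdAux-old seen ν eq))
      (cong (_∧ listEqᵇ (stdAux seen ν) lam) (≢⇒≡ᵇ-false j≢i))) (extend n (next b c)))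
    (filterᵇ-false (extend n (next b c)))

  branch-head-≡ : ∀ {c i} → indexOf c seen ≡ just i → c < b →
    branch seen n b i lam c ≡ matches seen n b lam
  branch-head-≡ {c} {i} eq c<b = trans
    (filterᵇ-cong (λ ν → trans (cong (λ z → listEqᵇ z (i ∷ lam)) (stdAux-old seen ν eq))
      (cong (_∧ listEqᵇ (stdAux seen ν) lam) (≡ᵇ-refl i))) (extend n (next b c)))
    (cong (filterᵇ (λ ν → listEqᵇ (stdAux seen ν) lam) ∘ extend n) (next-old c<b))

  branch-new : ∀ {c} → indexOf c seen ≡ nothing →
    branch seen n b (length seen) lam c ≡ matches (seen ++ c ∷ []) n (next b c) lam
  branch-new {c} eq =
    filterᵇ-cong (λ ν → trans (cong (λ z → listEqᵇ z (length seen ∷ lam)) (stdAux-new seen ν eq))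
      (cong (_∧ listEqᵇ (stdAux (seen ++ c ∷ []) ν) lam) (≡ᵇ-refl (length seen)))) (extend n (next b c))

  branch-new-≢ : ∀ {c i} → indexOf c seen ≡ nothing → i < length seen → branch seen n b i lam c ≡ []
  branch-new-≢ {c} {i} eq i<s = trans
    (filterᵇ-cong (λ ν → trans (cong (λ z → listEqᵇ z (i ∷ lam)) (stdAux-new seen ν eq))
      (cong (_∧ listEqᵇ (stdAux (seen ++ c ∷ []) ν) lam) (≢⇒≡ᵇ-false (<⇒≢ i<s ∘ sym)))) (extend n (next b c)))
    (filterᵇ-false (extend n (next b c)))

concatMap-empty : ∀ {A : Set} (f : ℕ → List A) g n → (∀ d → d < n → f (g d) ≡ []) →
  concatMap f (applyUpTo g n) ≡ []
concatMap-empty f g zero    h = refl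
concatMap-empty f g (suc n) h rewrite h 0 (s≤s z≤n) = concatMap-empty f (g ∘ suc) n (λ d → h (suc d) ∘ s≤s)

concatMap-single : ∀ {A : Set} (f : ℕ → List A) g {n c} → c < n →
  (∀ d → d < n → d ≢ c → f (g d) ≡ []) → concatMap f (applyUpTo g n) ≡ f (g c)
concatMap-single f g {suc n} {zero} _ h
  rewrite concatMap-empty f (g ∘ suc) n (λ d d<n → h (suc d) (s≤s d<n) λ ()) = ++-identityʳ (f (g 0))
concatMap-single f g {suc n} {suc c} (s≤s c<n) h rewrite h 0 (s≤s z≤n) (λ ()) =
  concatMap-single f (g ∘ suc) c<n (λ d d<n d≢c → h (suc d) (s≤s d<n) (d≢c ∘ suc-injective))

-- As `indexOf` returns a first occurrence, this also says that `seen` has no repetitions.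
Bounded : List ℕ → ℕ → Set
Bounded seen b = ∀ i → i < length seen → ∃ λ c → indexOf c seen ≡ just i × c < b

Bounded-[] : ∀ b → Bounded [] b
Bounded-[] b i ()

length-∷ʳ : ∀ (seen : List ℕ) c → length (seen ++ c ∷ []) ≡ suc (length seen)
length-∷ʳ seen c = trans (length-++ seen) (+-comm _ 1)

Bounded-∷ʳ : ∀ seen {b b' c} → Bounded seen b → indexOf c seen ≡ nothing → b ≤ b' → c < b' →
  Bounded (seen ++ c ∷ []) b'
Bounded-∷ʳ seen {c = c} bd eq b≤b' c<b' i i<
  with m<1+n⇒m<n∨m≡n (subst (i <_) (length-∷ʳ seen c) i<)
... | inj₂ refl = c , indexOf-∷ʳ c seen eq , c<b'
... | inj₁ i<s with d , e , d<b ← bd i i<s = d , indexOf-++ seen (c ∷ []) e , ≤-trans d<b b≤b'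

indexOf-bounded : ∀ seen {b c i} → Bounded seen b → indexOf c seen ≡ just i → c < b
indexOf-bounded seen {b} {c} {i} bd eq with d , e , d<b ← bd i (indexOf-< seen eq) =
  subst (_< b) (indexOf-injective seen e eq) d<b

-- The label is forced: any other known label standardizes to a different index, and an unknown one
-- to `length seen`.
matches-old : ∀ seen {b i} n lam → Bounded seen b → i < length seen → ∃ λ c →
  indexOf c seen ≡ just i × c < b × matches seen (suc n) b (i ∷ lam) ≡ map (c ∷_) (matches seen n b lam)
matches-old seen {b} {i} n lam bd i<s with c , e , c<b ← bd i i<s =
  c , e , c<b , trans (matches-∷ seen n b i lam)
    (trans (concatMap-single _ id (m<n⇒m<1+n c<b) other)
           (cong (map (c ∷_)) (branch-head-≡ seen n b lam e c<b)))
  where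
  other : ∀ d → d < suc b → d ≢ c → map (d ∷_) (branch seen n b i lam d) ≡ []
  other d _ d≢c = by-cases (indexOf d seen) refl
    where
    by-cases : ∀ o → indexOf d seen ≡ o → map (d ∷_) (branch seen n b i lam d) ≡ []
    by-cases nothing  ed = cong (map (d ∷_)) (branch-new-≢ seen n b lam ed i<s)
    by-cases (just j) ed = cong (map (d ∷_)) (branch-head-≢ seen n b lam ed
      λ { refl → d≢c (indexOf-injective seen ed e) })

known : List ℕ → ℕ → Bool
known seen x = is-just (indexOf x seen)

known-∷ʳ : ∀ seen c x → known seen x ∨ (c ≡ᵇ x) ≡ known (seen ++ c ∷ []) x
known-∷ʳ seen c x with indexOf x seen in e
... | just i rewrite indexOf-++ seen (c ∷ []) e = refl
... | nothing with c ≟ x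
...   | yes refl rewrite indexOf-∷ʳ c seen e = ≡ᵇ-refl c
...   | no c≢x rewrite indexOf-∷ʳ-≢ seen (c≢x ∘ sym) e = ≢⇒≡ᵇ-false c≢x

hide-known-old : ∀ {c i} seen ν → indexOf c seen ≡ just i →
  hide (known seen) (firsts (c ∷ ν)) ≡ nothing ∷ hide (known seen) (firsts ν)
hide-known-old {c} seen ν eq rewrite eq = cong (nothing ∷_)
  (trans (hide-hide (known seen) (c ≡ᵇ_) (firsts ν)) (hide-cong absorb (firsts ν)))
  where
  absorb : ∀ x → known seen x ∨ (c ≡ᵇ x) ≡ known seen x
  absorb x with c ≟ x
  ... | yes refl rewrite eq = refl
  ... | no c≢x rewrite ≢⇒≡ᵇ-false c≢x = ∨-identityʳ _

hide-known-new : ∀ {c} seen ν → indexOf c seen ≡ nothing →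
  hide (known seen) (firsts (c ∷ ν)) ≡ just c ∷ hide (known (seen ++ c ∷ [])) (firsts ν)
hide-known-new {c} seen ν eq rewrite eq = cong (just c ∷_)
  (trans (hide-hide (known seen) (c ≡ᵇ_) (firsts ν)) (hide-cong (known-∷ʳ seen c) (firsts ν)))

concatMap-Pointwise : ∀ {A B : Set} {R : B → B → Set} {f g : A → List B} xs →
  (∀ x → x ∈ xs → Pointwise R (f x) (g x)) → Pointwise R (concatMap f xs) (concatMap g xs)
concatMap-Pointwise []       h = []
concatMap-Pointwise (x ∷ xs) h =
  Pointwise.++⁺ (h x (here refl)) (concatMap-Pointwise xs (λ y → h y ∘ there))

filterᵇ-Pointwise : ∀ {A : Set} {R : A → A → Set} (p : A → Bool) → (∀ {x y} → R x y → p x ≡ p y) →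
  ∀ {xs ys} → Pointwise R xs ys → Pointwise R (filterᵇ p xs) (filterᵇ p ys)
filterᵇ-Pointwise p resp [] = []
filterᵇ-Pointwise p resp {x ∷ xs} {y ∷ ys} (r ∷ rs) with p x | p y | resp r
... | true  | .true  | refl = r ∷ filterᵇ-Pointwise p resp rs
... | false | .false | refl = filterᵇ-Pointwise p resp rs

-- The suffixes may differ in the labels that continue blocks. With the known labels hidden only the
-- labels at minima remain, which is all that letters joined in front can see.
record Twin (seen lam pi ν ν' : List ℕ) : Set where
  constructor twin
  field
    std-left  : stdAux seen ν ≡ lam
    std-right : stdAux seen ν' ≡ pi
    same-word : hide (known seen) (firsts ν) ≡ hide (known seen) (firsts ν')

-- Where a block continues, the forced labels may differ between the patterns, but both become
-- `nothing` in the word. Where a block opens, both patterns run through the same candidates `c` in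
-- the same order.
matches-twins : ∀ {seen s b lam pi w} → length seen ≡ s → Bounded seen b → RGS s lam w → RGS s pi w →
  Pointwise (Twin seen lam pi) (matches seen (length w) b lam) (matches seen (length w) b pi)
matches-twins _ bd done done = twin refl refl refl ∷ []
matches-twins {seen} {s} {b} {i ∷ lam} {j ∷ pi} {_ ∷ w} refl bd (old i<s r) (old j<s r')
  with c , ec , _ , eq ← matches-old seen (length w) lam bd i<s
     | d , ed , _ , eq' ← matches-old seen (length w) pi bd j<s =
  subst₂ (Pointwise (Twin seen (i ∷ lam) (j ∷ pi))) (sym eq) (sym eq')
    (Pointwise.map⁺ (c ∷_) (d ∷_) (Pointwise.map step (matches-twins refl bd r r')))
  where
  step : ∀ {ν ν'} → Twin seen lam pi ν ν' → Twin seen (i ∷ lam) (j ∷ pi) (c ∷ ν) (d ∷ ν')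
  step {ν} {ν'} (twin e e' h) = twin
    (trans (stdAux-old seen ν ec) (cong (i ∷_) e))
    (trans (stdAux-old seen ν' ed) (cong (j ∷_) e'))
    (trans (hide-known-old seen ν ec) (trans (cong (nothing ∷_) h) (sym (hide-known-old seen ν' ed))))
matches-twins {seen} {s} {b} {_ ∷ lam} {_ ∷ pi} {_ ∷ w} refl bd (new r) (new r') =
  subst₂ (Pointwise (Twin seen (s ∷ lam) (s ∷ pi)))
    (sym (matches-∷ seen (length w) b s lam)) (sym (matches-∷ seen (length w) b s pi))
    (concatMap-Pointwise (upTo (suc b)) λ c c∈ → Pointwise.map⁺ (c ∷_) (c ∷_) (at c (∈-upTo⁻ c∈)))
  where
  at : ∀ c → c < suc b → Pointwise (λ ν ν' → Twin seen (s ∷ lam) (s ∷ pi) (c ∷ ν) (c ∷ ν'))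
    (branch seen (length w) b s lam c) (branch seen (length w) b s pi c)
  at c c≤b = by-cases (indexOf c seen) refl
    where
    step : ∀ {ν ν'} → indexOf c seen ≡ nothing → Twin (seen ++ c ∷ []) lam pi ν ν' →
      Twin seen (s ∷ lam) (s ∷ pi) (c ∷ ν) (c ∷ ν')
    step {ν} {ν'} eq (twin e e' h) = twin
      (trans (stdAux-new seen ν eq) (cong (s ∷_) e))
      (trans (stdAux-new seen ν' eq) (cong (s ∷_) e'))
      (trans (hide-known-new seen ν eq) (trans (cong (just c ∷_) h) (sym (hide-known-new seen ν' eq))))
    by-cases : ∀ o → indexOf c seen ≡ o → Pointwise (λ ν ν' → Twin seen (s ∷ lam) (s ∷ pi) (c ∷ ν) (c ∷ ν'))
      (branch seen (length w) b s lam c) (branch seen (length w) b s pi c)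
    by-cases (just k) eq = subst₂ (Pointwise _)
      (sym (branch-head-≢ seen (length w) b lam eq (<⇒≢ (indexOf-< seen eq))))
      (sym (branch-head-≢ seen (length w) b pi eq (<⇒≢ (indexOf-< seen eq)))) []
    by-cases nothing eq = subst₂ (Pointwise _)
      (sym (branch-new seen (length w) b lam eq)) (sym (branch-new seen (length w) b pi eq))
      (Pointwise.map (step eq) (matches-twins (length-∷ʳ seen c)
        (Bounded-∷ʳ seen bd eq (next-≥ b c) (next-> c≤b)) r r'))

-- The word is carried along because the nestings gained by the next letter in front are read off
-- from it.
Same : List ℕ → List ℕ → Set
Same μ μ' = nestings μ ≡ nestings μ' × firsts μ ≡ firsts μ'

Same-∷ : ∀ c {μ μ'} → Same μ μ' → Same (c ∷ μ) (c ∷ μ')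
Same-∷ c (e , f) = cong₂ _+_ e (cong (before 0 c) f) , cong (λ w → just c ∷ hide (c ≡ᵇ_) w) f

extends : ℕ → List ℕ → List ℕ → Bool
extends l lam μ = listEqᵇ (std (drop l μ)) lam

extensions-Same : ∀ {lam pi w} → RGS 0 lam w → RGS 0 pi w → nestings lam ≡ nestings pi → ∀ l b →
  Pointwise Same (filterᵇ (extends l lam) (extend (l + length w) b))
                 (filterᵇ (extends l pi) (extend (l + length w) b))
extensions-Same {lam} {pi} r r' e zero b =
  Pointwise.map same (matches-twins refl (Bounded-[] b) r r')
  where
  same : ∀ {ν ν'} → Twin [] lam pi ν ν' → Same ν ν'
  same {ν} {ν'} (twin el er h) =
    trans (sym (nestings-std ν)) (trans (cong nestings el)
      (trans e (trans (cong nestings (sym er)) (nestings-std ν')))) ,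
    trans (sym (hide-none (firsts ν))) (trans h (hide-none (firsts ν')))
extensions-Same {lam} {pi} {w} r r' e (suc l) b =
  subst₂ (Pointwise Same)
    (sym (filterᵇ-extend (extends (suc l) lam) (l + length w) b))
    (sym (filterᵇ-extend (extends (suc l) pi) (l + length w) b))
    (concatMap-Pointwise (upTo (suc b)) λ c _ →
      Pointwise.map⁺ (c ∷_) (c ∷_) (Pointwise.map (Same-∷ c) (extensions-Same r r' e l (next b c))))

top : Word → ℕ
top []            = 0
top (nothing ∷ w) = top w
top (just c ∷ w)  = suc c ⊔ top w

top-hide : ∀ c w → suc c ⊔ top (hide (c ≡ᵇ_) w) ≡ suc c ⊔ top w
top-hide c []            = refl
top-hide c (nothing ∷ w) = top-hide c w
top-hide c (just d ∷ w) with c ≟ d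
... | yes refl rewrite ≡ᵇ-refl c = begin
  suc c ⊔ top (hide (c ≡ᵇ_) w)  ≡⟨ top-hide c w ⟩
  suc c ⊔ top w                 ≡⟨ cong (_⊔ top w) (⊔-idem (suc c)) ⟨
  suc c ⊔ suc c ⊔ top w         ≡⟨ ⊔-assoc (suc c) (suc c) (top w) ⟩
  suc c ⊔ (suc c ⊔ top w)       ∎
  where open ≡-Reasoning
... | no c≢d rewrite ≢⇒≡ᵇ-false c≢d = begin
  suc c ⊔ (suc d ⊔ top (hide (c ≡ᵇ_) w))  ≡⟨ swap (top (hide (c ≡ᵇ_) w)) ⟩
  suc d ⊔ (suc c ⊔ top (hide (c ≡ᵇ_) w))  ≡⟨ cong (suc d ⊔_) (top-hide c w) ⟩
  suc d ⊔ (suc c ⊔ top w)                 ≡⟨ swap (top w) ⟨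
  suc c ⊔ (suc d ⊔ top w)                 ∎
  where
  open ≡-Reasoning
  swap : ∀ z → suc c ⊔ (suc d ⊔ z) ≡ suc d ⊔ (suc c ⊔ z)
  swap z = trans (sym (⊔-assoc (suc c) (suc d) z))
    (trans (cong (_⊔ z) (⊔-comm (suc c) (suc d))) (⊔-assoc (suc d) (suc c) z))

-- Every label shows in the word at the minimum of its block, so the filter by `m` respects `Same`.
blocks-firsts : ∀ μ → blocks μ ≡ top (firsts μ)
blocks-firsts []      = refl
blocks-firsts (c ∷ μ) = trans (cong (suc c ⊔_) (blocks-firsts μ)) (sym (top-hide c (firsts μ)))

descendants : ∀ {lam w} → RGS 0 lam w → ∀ l m → Desc lam l m ≡
  filterᵇ (λ μ → blocks μ ≡ᵇ m) (filterᵇ (extends l lam) (extend (l + length w) 0))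
descendants {lam} r l m = trans (filterᵇ-∧ (extends l lam) (λ μ → blocks μ ≡ᵇ m) (extend (length lam + l) 0))
  (cong (λ n → filterᵇ (λ μ → blocks μ ≡ᵇ m) (filterᵇ (extends l lam) (extend n 0)))
    (trans (+-comm (length lam) l) (cong (l +_) (RGS-length r))))

same-signature⇒∼ne : ∀ {lam pi w} → RGS 0 lam w → RGS 0 pi w → ne lam ≡ ne pi → lam ∼ne pi
same-signature⇒∼ne {lam} {pi} r r' e l m
  rewrite descendants r l m | descendants r' l m = ↭-reflexive
  (Pointwise.Pointwise-≡⇒≡ (Pointwise.map⁺ ne ne (Pointwise.map
    (λ {μ} {μ'} s → trans (ne≡nestings μ) (trans (proj₁ s) (sym (ne≡nestings μ'))))
    (filterᵇ-Pointwise (λ μ → blocks μ ≡ᵇ m) same-blocks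
      (extensions-Same r r' (trans (sym (ne≡nestings lam)) (trans e (ne≡nestings pi))) l 0)))))
  where
  same-blocks : ∀ {μ μ'} → Same μ μ' → (blocks μ ≡ᵇ m) ≡ (blocks μ' ≡ᵇ m)
  same-blocks {μ} {μ'} (_ , f) =
    cong (_≡ᵇ m) (trans (blocks-firsts μ) (trans (cong top f) (sym (blocks-firsts μ'))))

-- Recovering the signature

trues : List Bool → ℕ
trues []          = 0
trues (true ∷ w)  = suc (trues w)
trues (false ∷ w) = trues w

⊔-absorb : ∀ {b c} → c < b → ∀ x → b ⊔ (suc c ⊔ x) ≡ b ⊔ x
⊔-absorb {b} {c} c<b x = trans (sym (⊔-assoc b (suc c) x)) (cong (_⊔ x) (m≥n⇒m⊔n≡m c<b))

⊔-suc : ∀ b x → b ⊔ (suc b ⊔ x) ≡ suc b ⊔ x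
⊔-suc b x = trans (sym (⊔-assoc b (suc b) x)) (cong (_⊔ x) (m≤n⇒m⊔n≡n (n≤1+n b)))

listEqᵇ-sound : ∀ xs ys → T (listEqᵇ xs ys) → xs ≡ ys
listEqᵇ-sound []       []       _ = refl
listEqᵇ-sound (x ∷ xs) (y ∷ ys) t with x ≡ᵇ y in e
... | true = cong₂ _∷_ (≡ᵇ-true⇒≡ x y e) (listEqᵇ-sound xs ys t)

matches-sound : ∀ seen n b lam → All (λ ν → stdAux seen ν ≡ lam) (matches seen n b lam)
matches-sound seen n b lam = All.map (λ {ν} → listEqᵇ-sound (stdAux seen ν) lam)
  (All.all-filter (λ ν → T? (listEqᵇ (stdAux seen ν) lam)) (extend n b))

Full : List ℕ → ℕ → Set
Full seen b = ∀ c → c < b → ∃ λ i → indexOf c seen ≡ just i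

indexOf-unbounded : ∀ seen {b} → Bounded seen b → indexOf b seen ≡ nothing
indexOf-unbounded seen {b} bd with indexOf b seen in e
... | nothing = refl
... | just i  = ⊥-elim (<-irrefl refl (indexOf-bounded seen bd e))

Full-∷ʳ : ∀ seen {b} → Full seen b → indexOf b seen ≡ nothing → Full (seen ++ b ∷ []) (suc b)
Full-∷ʳ seen {b} full eq c c≤b with m<1+n⇒m<n∨m≡n c≤b
... | inj₂ refl = length seen , indexOf-∷ʳ b seen eq
... | inj₁ c<b with i , e ← full c c<b = i , indexOf-++ seen (b ∷ []) e

-- When all open labels have been seen, a new block of the pattern can only take label `b`, so
-- nothing is left to choose. The maximum with `b` accounts for open labels that `ν` does not use.
matches-full : ∀ seen {b lam w} → length seen ≡ b → Bounded seen b → Full seen b → RGS b lam w →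
  ∃ λ ν → matches seen (length w) b lam ≡ ν ∷ [] × b ⊔ blocks ν ≡ b + trues w
matches-full seen {b} refl bd full done = [] , refl , trans (⊔-identityʳ b) (sym (+-identityʳ b))
matches-full seen {b} {i ∷ lam} {_ ∷ w} refl bd full (old i<b r)
  with c , ec , c<b , eq ← matches-old seen (length w) lam bd i<b
     | ν , eν , bν ← matches-full seen refl bd full r =
  c ∷ ν , trans eq (cong (map (c ∷_)) eν) , trans (⊔-absorb c<b (blocks ν)) bν
matches-full seen {b} {_ ∷ lam} {_ ∷ w} refl bd full (new r)
  with eb ← indexOf-unbounded seen bd
  with ν , eν , bν ← matches-full (seen ++ b ∷ []) (length-∷ʳ seen b)
         (Bounded-∷ʳ seen bd eb (n≤1+n b) ≤-refl) (Full-∷ʳ seen full eb) r =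
  b ∷ ν ,
  trans (matches-∷ seen (length w) b b lam) (trans (concatMap-single _ id ≤-refl other)
    (cong (map (b ∷_)) (trans (branch-new seen (length w) b lam eb)
      (trans (cong (λ z → matches (seen ++ b ∷ []) (length w) z lam) (next-new b)) eν)))) ,
  trans (⊔-suc b (blocks ν)) (trans bν (sym (+-suc b _)))
  where
  other : ∀ d → d < suc b → d ≢ b → map (d ∷_) (branch seen (length w) b b lam d) ≡ []
  other d d≤b d≢b with j , ed ← full d (≤∧≢⇒< (≤-pred d≤b) d≢b) =
    cong (map (d ∷_)) (branch-head-≢ seen (length w) b lam ed (<⇒≢ (indexOf-< seen ed)))

-- The numbers of nestings gained by joining a new first element to the
-- respective blocks, starting from a.
offsets : ℕ → List Bool → List ℕ
offsets a []          = []
offsets a (true ∷ w)  = a ∷ offsets a w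
offsets a (false ∷ w) = offsets (suc a) w

-- Label 0 is left out: it is the one open label that a block of the pattern may still join.
Full⁺ : List ℕ → ℕ → Set
Full⁺ seen s = ∀ c → c < s → ∃ λ i → indexOf (suc c) seen ≡ just i

Full⁺-∷ʳ-0 : ∀ seen {s} → indexOf 0 seen ≡ nothing → Full⁺ seen s → Full (seen ++ 0 ∷ []) (suc s)
Full⁺-∷ʳ-0 seen e full zero    _         = length seen , indexOf-∷ʳ 0 seen e
Full⁺-∷ʳ-0 seen e full (suc c) (s≤s c<s) with i , ei ← full c c<s = i , indexOf-++ seen (0 ∷ []) ei

Full⁺-∷ʳ : ∀ seen {s} → indexOf (suc s) seen ≡ nothing → Full⁺ seen s → Full⁺ (seen ++ suc s ∷ []) (suc s)
Full⁺-∷ʳ seen {s} e full c c≤s with m<1+n⇒m<n∨m≡n c≤s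
... | inj₂ refl = length seen , indexOf-∷ʳ (suc s) seen e
... | inj₁ c<s with i , ei ← full c c<s = i , indexOf-++ seen (suc s ∷ []) ei

-- Label 0 belongs to the new first element; the condition on the number of
-- blocks forces it to be used by exactly one block of lam.
join-offsets : ∀ seen {s lam w k} a → length seen ≡ s → Bounded seen (suc s) →
  indexOf 0 seen ≡ nothing → Full⁺ seen s →
  RGS s lam w → s + trues w ≡ k →
  map (λ ν → before a 0 (hide (known seen) (firsts ν)))
      (filterᵇ (λ ν → suc s ⊔ blocks ν ≡ᵇ k) (matches seen (length w) (suc s) lam))
  ≡ offsets a w
-- No block has joined label 0, so there are `suc s` blocks, one more than `k`, and the only
-- candidate is filtered out.
join-offsets seen {s} a refl bd e0 full done refl
  rewrite ≢⇒≡ᵇ-false {suc s} {s + 0} (λ e → 1+n≢n (trans e (+-identityʳ s))) = refl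
join-offsets seen {s} {i ∷ lam} {_ ∷ w} {k} a refl bd e0 full (old i<s r) ek
  with c , ec , c<b , eq ← matches-old seen (length w) lam bd i<s = begin
  map g (filterᵇ p (matches seen (suc (length w)) (suc s) (i ∷ lam)))
    ≡⟨ cong (map g ∘ filterᵇ p) eq ⟩
  map g (filterᵇ p (map (c ∷_) M))
    ≡⟨ cong (map g) (filterᵇ-map p (c ∷_) M) ⟩
  map g (map (c ∷_) (filterᵇ (p ∘ (c ∷_)) M))
    ≡⟨ map-∘ (filterᵇ (p ∘ (c ∷_)) M) ⟨
  map (g ∘ (c ∷_)) (filterᵇ (p ∘ (c ∷_)) M)
    ≡⟨ cong (map (g ∘ (c ∷_))) (filterᵇ-cong (λ ν → cong (_≡ᵇ k) (⊔-absorb c<b (blocks ν))) M) ⟩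
  map (g ∘ (c ∷_)) (filterᵇ p M)
    ≡⟨ map-cong (λ ν → cong (before a 0) (hide-known-old seen ν ec)) (filterᵇ p M) ⟩
  map (λ ν → before (suc a) 0 (hide (known seen) (firsts ν))) (filterᵇ p M)
    ≡⟨ join-offsets seen (suc a) refl bd e0 full r ek ⟩
  offsets (suc a) w ∎
  where
  open ≡-Reasoning
  M : List (List ℕ)
  M = matches seen (length w) (suc s) lam
  g : List ℕ → ℕ
  g ν = before a 0 (hide (known seen) (firsts ν))
  p : List ℕ → Bool
  p ν = suc s ⊔ blocks ν ≡ᵇ k
join-offsets seen {s} {_ ∷ lam} {_ ∷ w} {k} a refl bd e0 full (new r) ek
  with es ← indexOf-unbounded seen bd
  with ν₀ , eν , bν ← matches-full (seen ++ 0 ∷ []) (length-∷ʳ seen 0)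
         (Bounded-∷ʳ seen bd e0 ≤-refl (s≤s z≤n)) (Full⁺-∷ʳ-0 seen e0 full) r = begin
  map g (filterᵇ p (matches seen (suc (length w)) (suc s) (s ∷ lam)))
    ≡⟨ cong (map g ∘ filterᵇ p) (matches-∷ seen (length w) (suc s) s lam) ⟩
  -- Label 0 joins this block to the new element; the rest is then forced and contributes the single
  -- value `a`. Labels 1 to `s` already belong to other blocks. Label `suc s` keeps the block
  -- separate and postpones the join.
  map g (filterᵇ p (F 0 ++ concatMap F (applyUpTo suc (suc s))))
    ≡⟨ cong (map g ∘ filterᵇ p) (cong₂ _++_
         (cong (map (0 ∷_)) (trans (branch-new seen (length w) (suc s) lam e0) eν))
         (trans (concatMap-single F suc ≤-refl (other full))
           (cong (map (suc s ∷_)) (trans (branch-new seen (length w) (suc s) lam es)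
             (cong (λ z → matches (seen ++ suc s ∷ []) (length w) z lam) (next-new (suc s))))))) ⟩
  map g (filterᵇ p ((0 ∷ ν₀) ∷ map (suc s ∷_) M))
    ≡⟨ cong (map g) (accept (0 ∷ ν₀) (map (suc s ∷_) M)
         (trans (cong (_≡ᵇ k) (trans (⊔-absorb (s≤s z≤n) (blocks ν₀))
           (trans bν (trans (sym (+-suc s (trues w))) ek)))) (≡ᵇ-refl k))) ⟩
  g (0 ∷ ν₀) ∷ map g (filterᵇ p (map (suc s ∷_) M))
    ≡⟨ cong₂ _∷_ (cong (before a 0) (hide-known-new seen ν₀ e0)) (begin
         map g (filterᵇ p (map (suc s ∷_) M))
           ≡⟨ cong (map g) (filterᵇ-map p (suc s ∷_) M) ⟩
         map g (map (suc s ∷_) (filterᵇ (p ∘ (suc s ∷_)) M))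
           ≡⟨ map-∘ (filterᵇ (p ∘ (suc s ∷_)) M) ⟨
         map (g ∘ (suc s ∷_)) (filterᵇ (p ∘ (suc s ∷_)) M)
           ≡⟨ cong (map (g ∘ (suc s ∷_)))
                (filterᵇ-cong (λ ν → cong (_≡ᵇ k) (⊔-suc (suc s) (blocks ν))) M) ⟩
         map (g ∘ (suc s ∷_)) (filterᵇ q M)
           ≡⟨ map-cong (λ ν → cong (before a 0) (hide-known-new seen ν es)) (filterᵇ q M) ⟩
         map (λ ν → before a 0 (hide (known (seen ++ suc s ∷ [])) (firsts ν))) (filterᵇ q M)
           ≡⟨ join-offsets (seen ++ suc s ∷ []) a (length-∷ʳ seen (suc s))
                (Bounded-∷ʳ seen bd es (n≤1+n _) ≤-refl)
                (indexOf-∷ʳ-≢ seen (λ ()) e0) (Full⁺-∷ʳ seen es full) r (trans (sym (+-suc s _)) ek) ⟩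
         offsets a w ∎) ⟩
  a ∷ offsets a w ∎
  where
  open ≡-Reasoning
  M : List (List ℕ)
  M = matches (seen ++ suc s ∷ []) (length w) (suc (suc s)) lam
  g : List ℕ → ℕ
  g ν = before a 0 (hide (known seen) (firsts ν))
  p q : List ℕ → Bool
  p ν = suc s ⊔ blocks ν ≡ᵇ k
  q ν = suc (suc s) ⊔ blocks ν ≡ᵇ k
  F : ℕ → List (List ℕ)
  F c = map (c ∷_) (branch seen (length w) (suc s) s lam c)
  accept : ∀ ν νs → p ν ≡ true → filterᵇ p (ν ∷ νs) ≡ ν ∷ filterᵇ p νs
  accept ν νs e rewrite e = refl
  other : Full⁺ seen s →
    ∀ d → d < suc s → d ≢ s → F (suc d) ≡ []
  other full d d≤s d≢s with j , ed ← full d (≤∧≢⇒< (≤-pred d≤s) d≢s) =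
    cong (map (suc d ∷_)) (branch-head-≢ seen (length w) (suc s) lam ed (<⇒≢ (indexOf-< seen ed)))

ne-self : ∀ {lam w} → RGS 0 lam w → map ne (Desc lam 0 (trues w)) ≡ ne lam ∷ []
ne-self {lam} {w} r with ν , eν , bν ← matches-full [] refl (Bounded-[] 0) (λ _ ()) r
                    with e ∷ [] ← subst (All (λ ν → std ν ≡ lam)) eν (matches-sound [] (length w) 0 lam)
  rewrite descendants r 0 (trues w) | eν | bν | ≡ᵇ-refl (trues w) =
  cong (_∷ []) (trans (ne≡nestings ν) (trans (sym (nestings-std ν)) (trans (cong nestings e) (sym (ne≡nestings lam)))))

-- Keeping the number of blocks excludes the child whose first element is a singleton. The others
-- correspond to the blocks of `lam`, each gaining the offset of the block joined.
ne-children : ∀ {lam w} → RGS 0 lam w →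
  map ne (Desc lam 1 (trues w)) ≡ map (ne lam +_) (offsets 0 w)
ne-children {lam} {w} r = begin
  map ne (Desc lam 1 k)
    ≡⟨ cong (map ne) (descendants r 1 k) ⟩
  map ne (filterᵇ q (filterᵇ (extends 1 lam) (extend (suc (length w)) 0)))
    ≡⟨ cong (map ne ∘ filterᵇ q) (trans (filterᵇ-extend (extends 1 lam) (length w) 0)
         (++-identityʳ (map (0 ∷_) M))) ⟩
  map ne (filterᵇ q (map (0 ∷_) M))
    ≡⟨ cong (map ne) (filterᵇ-map q (0 ∷_) M) ⟩
  map ne (map (0 ∷_) (filterᵇ p M))
    ≡⟨ map-∘ (filterᵇ p M) ⟨
  map (ne ∘ (0 ∷_)) (filterᵇ p M)
    ≡⟨ map-cong-local (All.filter⁺ (T? ∘ p) (All.map (λ {ν} → ne-join ν) (matches-sound [] (length w) 1 lam))) ⟩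
  map (λ ν → ne lam + before 0 0 (hide (known []) (firsts ν))) (filterᵇ p M)
    ≡⟨ map-∘ (filterᵇ p M) ⟩
  map (ne lam +_) (map (λ ν → before 0 0 (hide (known []) (firsts ν))) (filterᵇ p M))
    ≡⟨ cong (map (ne lam +_)) (join-offsets [] 0 refl (Bounded-[] 1) refl (λ _ ()) r refl) ⟩
  map (ne lam +_) (offsets 0 w) ∎
  where
  open ≡-Reasoning
  k : ℕ
  k = trues w
  M : List (List ℕ)
  M = matches [] (length w) 1 lam
  p q : List ℕ → Bool
  p ν = 1 ⊔ blocks ν ≡ᵇ k
  q μ = blocks μ ≡ᵇ k
  ne-join : ∀ ν → std ν ≡ lam → ne (0 ∷ ν) ≡ ne lam + before 0 0 (hide (known []) (firsts ν))
  ne-join ν e = trans (ne≡nestings (0 ∷ ν)) (cong₂ _+_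
    (trans (sym (nestings-std ν)) (trans (cong nestings e) (sym (ne≡nestings lam))))
    (cong (before 0 0) (sym (hide-none (firsts ν)))))

offsets-≥ : ∀ a w → All (a ≤_) (offsets a w)
offsets-≥ a []          = []
offsets-≥ a (true ∷ w)  = ≤-refl ∷ offsets-≥ a w
offsets-≥ a (false ∷ w) = All.map <⇒≤ (offsets-≥ (suc a) w)

-- A later minimum has at least as many non-minima before it; being sorted, the list can be
-- recovered from its multiset.
offsets-sorted : ∀ a w → AllPairs _≤_ (offsets a w)
offsets-sorted a []          = []
offsets-sorted a (true ∷ w)  = offsets-≥ a w ∷ offsets-sorted a w
offsets-sorted a (false ∷ w) = offsets-sorted (suc a) w

-- Non-minima after the last minimum leave no trace in the offsets; the equal lengths recover them.
offsets-injective : ∀ a w w' → length w ≡ length w' → offsets a w ≡ offsets a w' → w ≡ w'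
offsets-injective a [] [] _ _ = refl
offsets-injective a (true ∷ w) (true ∷ w') e eq =
  cong (true ∷_) (offsets-injective a w w' (suc-injective e) (∷-injectiveʳ eq))
offsets-injective a (false ∷ w) (false ∷ w') e eq =
  cong (false ∷_) (offsets-injective (suc a) w w' (suc-injective e) eq)
offsets-injective a (true ∷ w) (false ∷ w') e eq
  with a<a ∷ _ ← subst (All (suc a ≤_)) (sym eq) (offsets-≥ (suc a) w') = ⊥-elim (<-irrefl refl a<a)
offsets-injective a (false ∷ w) (true ∷ w') e eq
  with a<a ∷ _ ← subst (All (suc a ≤_)) eq (offsets-≥ (suc a) w) = ⊥-elim (<-irrefl refl a<a)

sorted-↭⇒≡ : ∀ {xs ys} → AllPairs _≤_ xs → AllPairs _≤_ ys → xs ↭ ys → xs ≡ ys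
sorted-↭⇒≡ xs↗ ys↗ xs↭ys = Pointwise.Pointwise-≡⇒≡
  (↗↭↗⇒≋ ≤-totalOrder (AllPairs⇒Linked xs↗) (AllPairs⇒Linked ys↗) (↭⇒↭ₛ xs↭ys))

∼ne⇒same-signature : ∀ {lam pi w w'} → RGS 0 lam w → RGS 0 pi w' →
  length w ≡ length w' → trues w ≡ trues w' → lam ∼ne pi → ne lam ≡ ne pi × w ≡ w'
∼ne⇒same-signature {lam} {pi} {w} {w'} r r' el et sim = ne≡ ,
  offsets-injective 0 w w' el (map-injective (+-cancelˡ-≡ (ne lam) _ _)
    (sorted-↭⇒≡ (sorted (ne lam) w) (sorted (ne lam) w') children))
  where
  sorted : ∀ x w → AllPairs _≤_ (map (x +_) (offsets 0 w))
  sorted x w = AllPairs.map⁺ (AllPairs.map (+-monoʳ-≤ x) (offsets-sorted 0 w))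
  selves : ne lam ∷ [] ↭ ne pi ∷ []
  selves = subst₂ _↭_ (ne-self r)
    (trans (cong (map ne ∘ Desc pi 0) et) (ne-self r')) (sim 0 (trues w))
  ne≡ : ne lam ≡ ne pi
  ne≡ = ∷-injectiveˡ (↭-singleton-inv selves)
  children : map (ne lam +_) (offsets 0 w) ↭ map (ne lam +_) (offsets 0 w')
  children = subst₂ _↭_ (ne-children r)
    (trans (cong (map ne ∘ Desc pi 1) et)
      (trans (ne-children r') (cong (λ x → map (x +_) (offsets 0 w')) (sym ne≡)))) (sim 1 (trues w))

-- Nestings computed from left to right

occurs : ℕ → List ℕ → Bool
occurs d []      = false
occurs d (x ∷ μ) = (d ≡ᵇ x) ∨ occurs d μ

used : List ℕ → List ℕ → ℕ
used A μ = count (λ d → occurs d μ) A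

-- This is `before` on the word with `P` hidden, computed on the letters themselves: collecting the
-- met labels in `P` replaces the repeated hiding in the tail.
gap : ℕ → (ℕ → Bool) → ℕ → List ℕ → ℕ
gap a P d []      = 0
gap a P d (x ∷ μ) =
  if d ≡ᵇ x then a else gap (if P x then suc a else a) (λ y → P y ∨ (x ≡ᵇ y)) d μ

gap-cong : ∀ a {P Q} d μ → (∀ x → P x ≡ Q x) → gap a P d μ ≡ gap a Q d μ
gap-cong a d []      e = refl
gap-cong a d (x ∷ μ) e with d ≡ᵇ x
... | true  = refl
... | false rewrite e x = gap-cong _ d μ (λ y → cong (_∨ (x ≡ᵇ y)) (e y))

before-gap : ∀ a P d μ → P d ≡ false → before a d (hide P (firsts μ)) ≡ gap a P d μ
before-gap a P d []      Pd = refl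
before-gap a P d (x ∷ μ) Pd with d ≟ x
... | yes refl rewrite Pd | ≡ᵇ-refl d = refl
... | no d≢x rewrite ≢⇒≡ᵇ-false d≢x with P x
...   | true rewrite hide-hide P (x ≡ᵇ_) (firsts μ) =
  before-gap (suc a) (λ y → P y ∨ (x ≡ᵇ y)) d μ (cong₂ _∨_ Pd (≢⇒≡ᵇ-false (d≢x ∘ sym)))
...   | false rewrite ≢⇒≡ᵇ-false d≢x | hide-hide P (x ≡ᵇ_) (firsts μ) =
  before-gap a (λ y → P y ∨ (x ≡ᵇ y)) d μ (cong₂ _∨_ Pd (≢⇒≡ᵇ-false (d≢x ∘ sym)))

before-firsts : ∀ d μ → before 0 d (firsts μ) ≡ gap 0 (λ _ → false) d μ
before-firsts d μ = trans (cong (before 0 d) (sym (hide-none (firsts μ)))) (before-gap 0 _ d μ refl)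

gap-absent : ∀ a P {d μ} → All (d ≢_) μ → gap a P d μ ≡ 0
gap-absent a P []        = refl
gap-absent a P (d≢x ∷ h) rewrite ≢⇒≡ᵇ-false d≢x = gap-absent _ _ h

nestings-Unique : ∀ {μ} → Unique μ → nestings μ ≡ 0
nestings-Unique []                = refl
nestings-Unique {d ∷ μ} (d∉ ∷ u) =
  cong₂ _+_ (nestings-Unique u) (trans (before-firsts d μ) (gap-absent 0 _ d∉))

Fresh : (ℕ → Bool) → List ℕ → Set
Fresh P = All (λ x → P x ≡ false)

Fresh-∨ : ∀ {P x xs} → Fresh P xs → All (x ≢_) xs → Fresh (λ y → P y ∨ (x ≡ᵇ y)) xs
Fresh-∨ f x∉ = All.zipWith (λ (p , q) → cong₂ _∨_ p (≢⇒≡ᵇ-false q)) (f , x∉)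

gap-suc : ∀ a P d μ → gap (suc a) P d μ ≡ gap a P d μ + ind (occurs d μ)
gap-suc a P d []      = refl
gap-suc a P d (x ∷ μ) with d ≡ᵇ x
... | true  = +-comm 1 a
... | false with P x
...   | true  = gap-suc (suc a) _ d μ
...   | false = gap-suc a _ d μ

gap-first : ∀ a {P d} B μ → Fresh P B → All (d ≢_) B → Unique B → gap a P d (B ++ d ∷ μ) ≡ a
gap-first a {d = d} [] μ _ _ _ rewrite ≡ᵇ-refl d = refl
gap-first a (x ∷ B) μ (Px ∷ f) (d≢x ∷ d∉) (x∉ ∷ u) rewrite ≢⇒≡ᵇ-false d≢x | Px =
  gap-first a B μ (Fresh-∨ f x∉) d∉ u

-- Under `Q` the `c` after `B` counts as a repetition, under `P` as a first occurrence. The extra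
-- non-minimum is noticed exactly when `d` still follows.
gap-repeat : ∀ a {P Q d c} B μ → (∀ y → Q y ≡ P y ∨ (c ≡ᵇ y)) → P c ≡ false → Fresh P B →
  d ≢ c → All (d ≢_) B → All (c ≢_) B → Unique B →
  gap a Q d (B ++ c ∷ μ) ≡ gap a P d (B ++ c ∷ μ) + ind (occurs d μ)
gap-repeat a {P} {Q} {d} {c} [] μ Q≗ Pc _ d≢c _ _ _
  rewrite ≢⇒≡ᵇ-false d≢c | Q≗ c | Pc | ≡ᵇ-refl c =
  trans (gap-suc a (λ y → Q y ∨ (c ≡ᵇ y)) d μ)
    (cong (_+ ind (occurs d μ)) (gap-cong a d μ λ y → trans (cong (_∨ (c ≡ᵇ y)) (Q≗ y))
      (trans (∨-assoc (P y) _ _) (cong (P y ∨_) (∨-idem (c ≡ᵇ y))))))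
gap-repeat a {P} {Q} {d} {c} (x ∷ B) μ Q≗ Pc (Px ∷ f) d≢c (d≢x ∷ d∉) (c≢x ∷ c∉) (x∉ ∷ u)
  rewrite ≢⇒≡ᵇ-false d≢x | Q≗ x | Px | ≢⇒≡ᵇ-false c≢x =
  gap-repeat a B μ
    (λ y → trans (cong (_∨ (x ≡ᵇ y)) (Q≗ y)) (trans (∨-assoc (P y) _ _)
      (trans (cong (P y ∨_) (∨-comm (c ≡ᵇ y) (x ≡ᵇ y))) (sym (∨-assoc (P y) _ _)))))
    (cong₂ _∨_ Pc (≢⇒≡ᵇ-false (c≢x ∘ sym))) (Fresh-∨ f x∉) d≢c d∉ c∉ u

gap-insert : ∀ a {P d c} X B μ → Fresh P (X ++ c ∷ B) → All (d ≢_) (X ++ c ∷ B) → Unique (X ++ c ∷ B) →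
  gap a P d (X ++ c ∷ B ++ c ∷ μ) ≡ gap a P d (X ++ B ++ c ∷ μ) + ind (occurs d μ)
gap-insert a {P} {d} {c} [] B μ (Pc ∷ f) (d≢c ∷ d∉) (c∉ ∷ u) rewrite ≢⇒≡ᵇ-false d≢c | Pc =
  gap-repeat a B μ (λ _ → refl) Pc f d≢c d∉ c∉ u
gap-insert a {P} {d} {c} (x ∷ X) B μ (Px ∷ f) (d≢x ∷ d∉) (x∉ ∷ u) rewrite ≢⇒≡ᵇ-false d≢x | Px =
  gap-insert a X B μ (Fresh-∨ f x∉) d∉ u

-- The arc joining the two c's is enclosed exactly by the arcs leading from A
-- to μ, and deleting the first c deletes this arc.
nestings-rotate : ∀ A {c} B μ → Unique (A ++ c ∷ B) →
  nestings (A ++ c ∷ B ++ c ∷ μ) ≡ nestings (A ++ B ++ c ∷ μ) + used A μ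
nestings-rotate [] {c} B μ (c∉ ∷ u) = cong (nestings (B ++ c ∷ μ) +_)
  (trans (before-firsts c (B ++ c ∷ μ)) (gap-first 0 B μ (All.universal (λ _ → refl) B) c∉ u))
nestings-rotate (d ∷ A) {c} B μ (d∉ ∷ u) = begin
  nestings (A ++ c ∷ B ++ c ∷ μ) + before 0 d (firsts (A ++ c ∷ B ++ c ∷ μ))
    ≡⟨ cong₂ _+_ (nestings-rotate A B μ u) (trans (before-firsts d (A ++ c ∷ B ++ c ∷ μ))
         (gap-insert 0 A B μ (All.universal (λ _ → refl) (A ++ c ∷ B)) d∉ u)) ⟩
  x + used A μ + (y + i)      ≡⟨ interchange +-commutativeSemigroup x (used A μ) y i ⟩
  x + y + (used A μ + i)      ≡⟨ cong₂ _+_ (cong (x +_) (sym (before-firsts d (A ++ B ++ c ∷ μ))))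
                                   (trans (+-comm (used A μ) i) (sym (count-∷ (λ d → occurs d μ) d A))) ⟩
  x + before 0 d (firsts (A ++ B ++ c ∷ μ)) + used (d ∷ A) μ ∎
  where
  open ≡-Reasoning
  x y i : ℕ
  x = nestings (A ++ B ++ c ∷ μ)
  y = gap 0 (λ _ → false) d (A ++ B ++ c ∷ μ)
  i = ind (occurs d μ)

-- The largest nesting number for given minima

falses : List Bool → ℕ
falses []          = 0
falses (true ∷ w)  = falses w
falses (false ∷ w) = suc (falses w)

-- The arc ending at a given non-minimum is enclosed by arcs which start in the
-- other blocks already opened and end at different later non-minima.
bound : ℕ → List Bool → ℕ
bound h []          = 0
bound h (true ∷ w)  = bound (suc h) w
bound h (false ∷ w) = (h ∸ 1) ⊓ falses w + bound h w

used-≤-suc : ∀ {U} c μ → Unique U → used U (c ∷ μ) ≤ suc (used U μ)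
used-≤-suc c μ [] = z≤n
used-≤-suc {d ∷ U} c μ (d∉ ∷ u)
  rewrite count-∷ (λ d → occurs d (c ∷ μ)) d U | count-∷ (λ d → occurs d μ) d U with d ≟ c
... | yes refl rewrite ≡ᵇ-refl d
    | count-cong {p = λ x → occurs x (d ∷ μ)} {λ x → occurs x μ}
        (All.map (λ {x} d≢x → cong (_∨ occurs x μ) (≢⇒≡ᵇ-false (d≢x ∘ sym))) d∉) =
  s≤s (m≤n+m _ (ind (occurs d μ)))
... | no d≢c rewrite ≢⇒≡ᵇ-false d≢c =
  ≤-trans (+-monoʳ-≤ (ind (occurs d μ)) (used-≤-suc c μ u)) (≤-reflexive (+-suc _ _))

-- Labels below `h` can recur only at non-minima, and one letter accounts for at most one of the
-- distinct labels in `U`.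
used-≤-falses : ∀ {U h μ w} → Unique U → All (_< h) U → RGS h μ w → used U μ ≤ falses w
used-≤-falses {U} u U<h done = ≤-reflexive (cong length (filterᵇ-false U))
used-≤-falses u U<h (old {c = c} {μ} _ r) = ≤-trans (used-≤-suc c μ u) (s≤s (used-≤-falses u U<h r))
used-≤-falses {U} {h} u U<h (new {μ = μ} r) = ≤-trans
  (≤-reflexive (count-cong (All.map (λ {x} x<h → cong (_∨ occurs x μ) (≢⇒≡ᵇ-false (<⇒≢ x<h))) U<h)))
  (used-≤-falses u (All.map m<n⇒m<1+n U<h) r)

module _ {h T} (T↭ : T ↭ upTo h) where

  order-Unique : Unique T
  order-Unique = PermutationSetoid.Unique-resp-↭ (setoid ℕ) (↭⇒↭ₛ (↭-sym T↭)) (Unique.upTo⁺ h)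

  order-< : All (_< h) T
  order-< = All.tabulate (∈-upTo⁻ ∘ ∈-resp-↭ T↭)

  order-length : length T ≡ h
  order-length = trans (↭-length T↭) (length-upTo h)

  order-new : T ++ h ∷ [] ↭ upTo (suc h)
  order-new = ↭-trans (++⁺ʳ (h ∷ []) T↭) (↭-reflexive (upTo-∷ʳ h))

order-rotate : ∀ {h} A {c} B → A ++ c ∷ B ↭ upTo h → A ++ B ++ c ∷ [] ↭ upTo h
order-rotate A {c} B T↭ = ↭-trans (++⁺ˡ A (↭-sym (∷↭∷ʳ c B))) T↭

Unique-++ˡ : ∀ (A : List ℕ) {B} → Unique (A ++ B) → Unique A
Unique-++ˡ []      _        = []
Unique-++ˡ (x ∷ A) (x∉ ∷ u) = All.++⁻ˡ A x∉ ∷ Unique-++ˡ A u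

-- Reading `c` makes its block the most recently extended one, so it moves to the end of the order;
-- `A` consists of the blocks with older latest elements.
nestings-rotate′ : ∀ A {c} B μ → Unique (A ++ c ∷ B) →
  nestings ((A ++ c ∷ B) ++ c ∷ μ) ≡ used A μ + nestings ((A ++ B ++ c ∷ []) ++ μ)
nestings-rotate′ A {c} B μ u = begin
  nestings ((A ++ c ∷ B) ++ c ∷ μ)                 ≡⟨ cong nestings (++-assoc A (c ∷ B) (c ∷ μ)) ⟩
  nestings (A ++ c ∷ B ++ c ∷ μ)                   ≡⟨ nestings-rotate A B μ u ⟩
  nestings (A ++ B ++ c ∷ μ) + used A μ            ≡⟨ +-comm _ (used A μ) ⟩
  used A μ + nestings (A ++ B ++ c ∷ μ)            ≡⟨ cong (λ z → used A μ + nestings z) (trans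
    (++-assoc A (B ++ c ∷ []) μ) (cong (A ++_) (++-assoc B (c ∷ []) μ))) ⟨
  used A μ + nestings ((A ++ B ++ c ∷ []) ++ μ)    ∎
  where open ≡-Reasoning

nestings-new : ∀ {h} T μ → nestings (T ++ h ∷ μ) ≡ nestings ((T ++ h ∷ []) ++ μ)
nestings-new {h} T μ = cong nestings (sym (++-assoc T (h ∷ []) μ))

-- T lists the blocks already opened by their latest elements, oldest first.
nestings-≤-bound : ∀ {h T μ w} → T ↭ upTo h → RGS h μ w → nestings (T ++ μ) ≤ bound h w
nestings-≤-bound {T = T} T↭ done =
  ≤-reflexive (trans (cong nestings (++-identityʳ T)) (nestings-Unique (order-Unique T↭)))
nestings-≤-bound {h} {T} T↭ (new {μ = μ} r) =
  ≤-trans (≤-reflexive (nestings-new T μ)) (nestings-≤-bound (order-new T↭) r)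
nestings-≤-bound {h} T↭ (old {c = c} {μ} c<h r)
  with A , B , refl ← ∈-∃++ (∈-resp-↭ (↭-sym T↭) (∈-upTo⁺ c<h)) =
  ≤-trans (≤-reflexive (nestings-rotate′ A B μ (order-Unique T↭)))
    (+-mono-≤
      (⊓-glb
        (≤-trans (length-filter _ A)
          (≤-trans (m≤m+n (length A) (length B)) (≤-reflexive (cong (_∸ 1)
            (trans (sym (+-suc (length A) (length B))) (trans (sym (length-++ A)) (order-length T↭)))))))
        (used-≤-falses (Unique-++ˡ A (order-Unique T↭)) (All.++⁻ˡ A (order-< T↭)) r))
      (nestings-≤-bound (order-rotate A B T↭) r))

-- Attaining every value up to the bound

split-at : ∀ {A : Set} t (xs : List A) → t < length xs →
  ∃₂ λ ys x → ∃ λ zs → xs ≡ ys ++ x ∷ zs × length ys ≡ t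
split-at zero    (x ∷ xs) _       = [] , x , xs , refl , refl
split-at (suc t) (x ∷ xs) (s≤s p) with ys , y , zs , refl , refl ← split-at t xs p =
  x ∷ ys , y , zs , refl , refl

take-++-≤ : ∀ {A : Set} u (xs ys : List A) → u ≤ length xs → take u (xs ++ ys) ≡ take u xs
take-++-≤ zero    xs       ys _       = refl
take-++-≤ (suc u) (x ∷ xs) ys (s≤s p) = cong (x ∷_) (take-++-≤ u xs ys p)

take-++-+ : ∀ {A : Set} (xs : List A) e ys → take (length xs + e) (xs ++ ys) ≡ xs ++ take e ys
take-++-+ []       e ys = refl
take-++-+ (x ∷ xs) e ys = cong (x ∷_) (take-++-+ xs e ys)

occurs-∈ : ∀ {d μ} → d ∈ μ → occurs d μ ≡ true
occurs-∈ {d} (here refl) rewrite ≡ᵇ-refl d = refl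
occurs-∈ {d} {x ∷ μ} (there p) rewrite occurs-∈ p = ∨-zeroʳ (d ≡ᵇ x)

used-all : ∀ {A μ} → All (_∈ μ) A → used A μ ≡ length A
used-all []                  = refl
used-all {d ∷ A} {μ} (p ∷ ps) =
  trans (count-∷ (λ d → occurs d μ) d A) (cong₂ _+_ (cong ind (occurs-∈ p)) (used-all ps))

-- Each non-minimum joins the block with t older ones below it, for a t not
-- exceeding the number of later non-minima. The third component says that the
-- older blocks will then all be continued, so that exactly t arcs enclose the
-- new one.
realise : ∀ {h T} w {v} → 1 ≤ h → T ↭ upTo h → v ≤ bound h w → ∃ λ μ →
  RGS h μ w × nestings (T ++ μ) ≡ v × (∀ u → u ≤ h → u ≤ falses w → All (_∈ μ) (take u T))
realise {T = T} [] h≥1 T↭ z≤n = [] , done ,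
  trans (cong nestings (++-identityʳ T)) (nestings-Unique (order-Unique T↭)) , λ { .0 _ z≤n → [] }
realise {h} {T} (true ∷ w) h≥1 T↭ v≤ with μ , r , e , all ← realise w (s≤s z≤n) (order-new T↭) v≤ =
  h ∷ μ , new r , trans (nestings-new T μ) e , λ u u≤h u≤f →
    All.map there (subst (All (_∈ μ))
      (take-++-≤ u T (h ∷ []) (≤-trans u≤h (≤-reflexive (sym (order-length T↭)))))
      (all u (m≤n⇒m≤1+n u≤h) u≤f))
realise {suc g} {T} (false ∷ w) {v} h≥1 T↭ v≤
  -- Greedy choice: this arc takes as much of `v` as its own bound `g ⊓ falses w` permits, and the
  -- rest of the word has to supply `v ∸ (g ⊓ falses w)`.
  with A , c , B , refl , eA ← split-at (g ⊓ falses w ⊓ v) T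
    (≤-trans (s≤s (≤-trans (m⊓n≤m _ v) (m⊓n≤m g _))) (≤-reflexive (sym (order-length T↭))))
  with μ , r , e , all ← realise w h≥1 (order-rotate A B T↭) (m≤n+o⇒m∸n≤o v (g ⊓ falses w) v≤) =
  c ∷ μ , old (All.lookup (order-< T↭) (∈-++⁺ʳ A (here refl))) r ,
  trans (nestings-rotate′ A B μ (order-Unique T↭))
    (trans (cong₂ _+_ (trans (used-all A-used) eA) e) (m⊓n+n∸m≡n (g ⊓ falses w) v)) , older
  where
  A≤f : length A ≤ falses w
  A≤f = ≤-trans (≤-reflexive eA) (≤-trans (m⊓n≤m _ v) (m⊓n≤n g _))
  lengths : length A + suc (length B) ≡ suc g
  lengths = trans (sym (length-++ A)) (order-length T↭)
  A≤h : length A ≤ suc g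
  A≤h = ≤-trans (m≤m+n _ _) (≤-reflexive lengths)
  A-used : All (_∈ μ) A
  A-used = All.++⁻ˡ A (subst (All (_∈ μ)) (trans (cong (λ z → take z (A ++ B ++ c ∷ []))
    (sym (+-identityʳ (length A)))) (take-++-+ A 0 _)) (all (length A) A≤h A≤f))
  older : ∀ u → u ≤ suc g → u ≤ suc (falses w) → All (_∈ c ∷ μ) (take u (A ++ c ∷ B))
  older u u≤h u≤f with u ≤? length A
  ... | yes u≤A = subst (All (_∈ c ∷ μ))
    (trans (take-++-≤ u A _ u≤A) (sym (take-++-≤ u A (c ∷ B) u≤A)))
    (All.map there (all u u≤h (≤-trans u≤A A≤f)))
  -- The `u` oldest blocks are `A`, `c` and the first `e` of `B`. Here `c` is the next letter, and
  -- the others are the oldest `u - 1` after the rotation, so the later non-minima suffice for them.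
  ... | no u≰A with e , refl ← m≤n⇒∃[o]m+o≡n (≰⇒> u≰A) = subst (All (_∈ c ∷ μ))
    (sym (trans (cong (λ z → take z (A ++ c ∷ B)) (sym (+-suc (length A) e))) (take-++-+ A (suc e) (c ∷ B))))
    (All.++⁺ (All.map there A-used) (here refl ∷ All.map there (All.++⁻ʳ A rest)))
    where
    e≤B : e ≤ length B
    e≤B = +-cancelˡ-≤ (suc (length A)) e (length B)
      (≤-trans u≤h (≤-reflexive (trans (sym lengths) (+-suc (length A) (length B)))))
    rest : All (_∈ μ) (A ++ take e B)
    rest = subst (All (_∈ μ)) (trans (take-++-+ A e (B ++ c ∷ [])) (cong (A ++_) (take-++-≤ e B (c ∷ []) e≤B)))
      (all (length A + e) (<⇒≤ u≤h) (≤-pred u≤f))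

-- Counting signatures

words : ℕ → ℕ → List (List Bool)
words zero    zero    = [] ∷ []
words zero    (suc k) = []
words (suc n) zero    = map (false ∷_) (words n zero)
words (suc n) (suc k) = map (true ∷_) (words n k) ++ map (false ∷_) (words n (suc k))

length-words : ∀ n k → length (words n k) ≡ n C k
length-words zero    zero    = refl
length-words zero    (suc k) = sym (k>n⇒nCk≡0 {0} {suc k} (s≤s z≤n))
length-words (suc n) zero    = trans (length-map _ (words n 0)) (length-words n 0)
length-words (suc n) (suc k) = trans (length-++ (map (true ∷_) (words n k)))
  (trans (cong₂ _+_ (trans (length-map _ (words n k)) (length-words n k))
                    (trans (length-map _ (words n (suc k))) (length-words n (suc k))))
         (nCk+nC[k+1]≡[n+1]C[k+1] n k))

words-falses : ∀ n k → All (λ w → falses w ≡ n ∸ k × k ≤ n) (words n k)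
words-falses zero    zero    = (refl , z≤n) ∷ []
words-falses zero    (suc k) = []
words-falses (suc n) zero    = All.map⁺ (All.map (λ (e , _) → cong suc e , z≤n) (words-falses n 0))
words-falses (suc n) (suc k) = All.++⁺
  (All.map⁺ (All.map (λ (e , k≤n) → e , s≤s k≤n) (words-falses n k)))
  (All.map⁺ (All.map (λ (e , k<n) → trans (cong suc e) (sym (+-∸-assoc 1 k<n)) , <⇒≤ (s≤s k<n))
    (words-falses n (suc k))))

sum-shift : ∀ {A : Set} {f g : A → ℕ} {x xs} → All (λ a → f a ≡ x + g a) xs →
  sum (map f xs) ≡ length xs * x + sum (map g xs)
sum-shift [] = refl
sum-shift {f = f} {g} {x} {a ∷ xs} (e ∷ es) = trans (cong₂ _+_ e (sum-shift es))
  (solve 4 (λ x y n s → (x :+ y) :+ (n :+ s) := x :+ n :+ (y :+ s)) refl x (g a) (length xs * x) (sum (map g xs)))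
  where open +-*-Solver

total : ℕ → ℕ → ℕ → ℕ
total h n k = sum (map (λ w → suc (bound h w)) (words n k))

total⁻ : ℕ → ℕ → ℕ → ℕ
total⁻ h n zero    = 0
total⁻ h n (suc k) = total h n k

total-false : ∀ g n k → sum (map (λ w → suc (bound (suc g) w)) (map (false ∷_) (words n k))) ≡
  total (suc g) n k + (n C k) * (g ⊓ (n ∸ k))
total-false g n k = begin
  sum (map (λ w → suc (bound (suc g) w)) (map (false ∷_) (words n k)))
    ≡⟨ cong sum (sym (map-∘ (words n k))) ⟩
  sum (map (λ w → suc (bound (suc g) (false ∷ w))) (words n k))
    ≡⟨ sum-shift (All.map (λ {w} (e , _) → trans (cong (λ z → suc (g ⊓ z + bound (suc g) w)) e) (sym (+-suc _ _)))
         (words-falses n k)) ⟩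
  length (words n k) * (g ⊓ (n ∸ k)) + total (suc g) n k
    ≡⟨ cong (λ z → z * (g ⊓ (n ∸ k)) + total (suc g) n k) (length-words n k) ⟩
  (n C k) * (g ⊓ (n ∸ k)) + total (suc g) n k
    ≡⟨ +-comm _ (total (suc g) n k) ⟩
  total (suc g) n k + (n C k) * (g ⊓ (n ∸ k)) ∎
  where open ≡-Reasoning

-- The first letter either opens a block, raising `h`, or is a non-minimum followed by `n ∸ k`
-- others, whose own term is then the same for all `n C k` remaining words.
total-first : ∀ g n k → total (suc g) (suc n) k ≡
  total⁻ (suc (suc g)) n k + (total (suc g) n k + (n C k) * (g ⊓ (n ∸ k)))
total-first g n zero    = total-false g n zero
total-first g n (suc k) = begin
  sum (map β (map (true ∷_) (words n k) ++ map (false ∷_) (words n (suc k))))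
    ≡⟨ cong sum (map-++ β (map (true ∷_) (words n k)) _) ⟩
  sum (map β (map (true ∷_) (words n k)) ++ map β (map (false ∷_) (words n (suc k))))
    ≡⟨ sum-++ (map β (map (true ∷_) (words n k))) _ ⟩
  sum (map β (map (true ∷_) (words n k))) + sum (map β (map (false ∷_) (words n (suc k))))
    ≡⟨ cong₂ _+_ (cong sum (sym (map-∘ (words n k)))) (total-false g n (suc k)) ⟩
  total (suc (suc g)) n k + (total (suc g) n (suc k) + (n C suc k) * (g ⊓ (n ∸ suc k))) ∎
  where
  open ≡-Reasoning
  β : List Bool → ℕ
  β w = suc (bound (suc g) w)

-- Appending a non-minimum to a word raises the bound by the number of
-- non-minima among the last k + g letters; this is the sum over words n k.
gain : ℕ → ℕ → ℕ → ℕ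
gain g zero    k = 0
gain g (suc n) k = (suc n ⊓ (k + g)) * (n C k)

-- Both windows have length `suc k + g`, so Pascal's rule merges the binomial coefficients.
gain-Pascal : ∀ g n k → gain (suc g) n k + gain g n (suc k) ≡ (n ⊓ (suc k + g)) * (n C suc k)
gain-Pascal g zero    k = refl
gain-Pascal g (suc n) k = begin
  (suc n ⊓ (k + suc g)) * (n C k) + (suc n ⊓ (suc k + g)) * (n C suc k)
    ≡⟨ cong (λ z → (suc n ⊓ z) * (n C k) + (suc n ⊓ (suc k + g)) * (n C suc k)) (+-suc k g) ⟩
  (suc n ⊓ (suc k + g)) * (n C k) + (suc n ⊓ (suc k + g)) * (n C suc k)
    ≡⟨ *-distribˡ-+ (suc n ⊓ (suc k + g)) (n C k) (n C suc k) ⟨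
  (suc n ⊓ (suc k + g)) * (n C k + n C suc k)
    ≡⟨ cong ((suc n ⊓ (suc k + g)) *_) (nCk+nC[k+1]≡[n+1]C[k+1] n k) ⟩
  (suc n ⊓ (suc k + g)) * (suc n C suc k) ∎
  where open ≡-Reasoning

-- For `n = suc k + y` both brackets equal `suc k + (g ⊓ y) + (g ⊓ suc y)`; for `n < suc k` the
-- binomial coefficient vanishes.
min-exchange : ∀ g n k →
  (n C suc k) * ((n ⊓ (suc k + g)) + (g ⊓ (n ∸ k))) ≡
  (n C suc k) * ((g ⊓ (n ∸ suc k)) + (suc n ⊓ (suc k + g)))
min-exchange g n k with suc k ≤? n
... | no k≮n rewrite k>n⇒nCk≡0 (≰⇒> k≮n) = refl
... | yes k<n with y , refl ← m≤n⇒∃[o]m+o≡n k<n = cong ((suc (k + y) C suc k) *_) (begin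
  (suc k + y) ⊓ (suc k + g) + (g ⊓ (suc k + y ∸ k))
    ≡⟨ cong₂ _+_ (sym (+-distribˡ-⊓ (suc k) y g))
         (cong (g ⊓_) (trans (cong (_∸ k) (sym (+-suc k y))) (m+n∸m≡n k (suc y)))) ⟩
  suc k + (y ⊓ g) + (g ⊓ suc y)
    ≡⟨ cong₂ _+_ (cong (suc k +_) (⊓-comm y g)) (⊓-comm g (suc y)) ⟩
  suc k + (g ⊓ y) + (suc y ⊓ g)
    ≡⟨ solve 3 (λ a b c → a :+ b :+ c := b :+ (a :+ c)) refl (suc k) (g ⊓ y) (suc y ⊓ g) ⟩
  (g ⊓ y) + (suc k + (suc y ⊓ g))
    ≡⟨ cong₂ _+_ (cong (g ⊓_) (sym (m+n∸m≡n (suc k) y)))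
         (trans (+-distribˡ-⊓ (suc k) (suc y) g) (cong (_⊓ (suc k + g)) (+-suc (suc k) y))) ⟩
  (g ⊓ (suc k + y ∸ suc k)) + (suc (suc k + y) ⊓ (suc k + g)) ∎)
  where
  open ≡-Reasoning
  open +-*-Solver

-- Unlike `total-first`, removing the last letter keeps `h`, and a final `true` leaves the bound
-- unchanged. The induction still expands both sides by the first letter, which raises `h`; hence
-- the generality in `g`, although the recurrence uses only `g = 0`.
total-last : ∀ g n k → total (suc g) (suc n) k ≡ total (suc g) n k + total⁻ (suc g) n k + gain g n k
total-last g zero zero = cong suc (cong (λ z → z + 0 + 0) (⊓-zeroʳ g))
total-last g (suc n) zero = begin
  total (suc g) (suc (suc n)) 0                    ≡⟨ total-first g (suc n) 0 ⟩
  total (suc g) (suc n) 0 + 1 * (g ⊓ suc n)        ≡⟨ cong₂ _+_ (sym (+-identityʳ _))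
                                                        (trans (*-comm 1 (g ⊓ suc n)) (cong (_* 1) (⊓-comm g (suc n)))) ⟩
  total (suc g) (suc n) 0 + 0 + (suc n ⊓ g) * 1    ∎
  where open ≡-Reasoning
total-last g zero (suc zero)    = refl
total-last g zero (suc (suc k)) = refl
total-last g (suc n) (suc k) = begin
  total (suc g) (suc (suc n)) (suc k)
    ≡⟨ total-first g (suc n) (suc k) ⟩
  total (2 + g) (suc n) k + (total (suc g) (suc n) (suc k) + (suc n C suc k) * (g ⊓ (n ∸ k)))
    ≡⟨ cong₂ (λ x y → x + (y + (suc n C suc k) * (g ⊓ (n ∸ k))))
         (total-last (suc g) n k) (total-last g n (suc k)) ⟩
  (a + b + gain (suc g) n k) + ((c + d + gain g n (suc k)) + (suc n C suc k) * (g ⊓ (n ∸ k)))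
    ≡⟨ solve 7 (λ a b c d x y z → (a :+ b :+ x) :+ ((c :+ d :+ y) :+ z) :=
                                  (a :+ b :+ (c :+ d)) :+ ((x :+ y) :+ z)) refl
         a b c d (gain (suc g) n k) (gain g n (suc k)) ((suc n C suc k) * (g ⊓ (n ∸ k))) ⟩
  (a + b + (c + d)) + ((gain (suc g) n k + gain g n (suc k)) + (suc n C suc k) * (g ⊓ (n ∸ k)))
    ≡⟨ cong ((a + b + (c + d)) +_) gains ⟩
  (a + b + (c + d)) + ((n C suc k) * (g ⊓ (n ∸ suc k)) + (n C k) * (g ⊓ (n ∸ k)) + gain g (suc n) (suc k))
    ≡⟨ solve 7 (λ a b c d x y z → (a :+ b :+ (c :+ d)) :+ (x :+ y :+ z) :=
                                  (a :+ (c :+ x)) :+ (b :+ (d :+ y)) :+ z) refl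
         a b c d ((n C suc k) * (g ⊓ (n ∸ suc k))) ((n C k) * (g ⊓ (n ∸ k))) (gain g (suc n) (suc k)) ⟩
  (a + (c + (n C suc k) * (g ⊓ (n ∸ suc k)))) + (b + (d + (n C k) * (g ⊓ (n ∸ k)))) + gain g (suc n) (suc k)
    ≡⟨ cong₂ (λ x y → x + y + gain g (suc n) (suc k)) (sym (total-first g n (suc k))) (sym (total-first g n k)) ⟩
  total (suc g) (suc n) (suc k) + total (suc g) (suc n) k + gain g (suc n) (suc k) ∎
  where
  open ≡-Reasoning
  open +-*-Solver
  a b c d : ℕ
  a = total (2 + g) n k
  b = total⁻ (2 + g) n k
  c = total (suc g) n (suc k)
  d = total (suc g) n k
  gains : (gain (suc g) n k + gain g n (suc k)) + (suc n C suc k) * (g ⊓ (n ∸ k)) ≡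
    (n C suc k) * (g ⊓ (n ∸ suc k)) + (n C k) * (g ⊓ (n ∸ k)) + gain g (suc n) (suc k)
  gains = begin
    (gain (suc g) n k + gain g n (suc k)) + (suc n C suc k) * (g ⊓ (n ∸ k))
      ≡⟨ cong₂ (λ x y → x + y * (g ⊓ (n ∸ k))) (gain-Pascal g n k) (sym (nCk+nC[k+1]≡[n+1]C[k+1] n k)) ⟩
    (n ⊓ (suc k + g)) * (n C suc k) + (n C k + n C suc k) * (g ⊓ (n ∸ k))
      ≡⟨ solve 4 (λ p c₁ c₀ q → p :* c₁ :+ (c₀ :+ c₁) :* q := c₁ :* (p :+ q) :+ c₀ :* q) refl
           (n ⊓ (suc k + g)) (n C suc k) (n C k) (g ⊓ (n ∸ k)) ⟩
    (n C suc k) * ((n ⊓ (suc k + g)) + (g ⊓ (n ∸ k))) + (n C k) * (g ⊓ (n ∸ k))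
      ≡⟨ cong (_+ (n C k) * (g ⊓ (n ∸ k))) (min-exchange g n k) ⟩
    (n C suc k) * ((g ⊓ (n ∸ suc k)) + (suc n ⊓ (suc k + g))) + (n C k) * (g ⊓ (n ∸ k))
      ≡⟨ solve 5 (λ c₁ p q c₀ r → c₁ :* (p :+ q) :+ c₀ :* r := c₁ :* p :+ c₀ :* r :+ q :* c₁) refl
           (n C suc k) (g ⊓ (n ∸ suc k)) (suc n ⊓ (suc k + g)) (n C k) (g ⊓ (n ∸ k)) ⟩
    (n C suc k) * (g ⊓ (n ∸ suc k)) + (n C k) * (g ⊓ (n ∸ k)) + gain g (suc n) (suc k) ∎

-- Element 1 is always a minimum, so it is dropped from the word and counted as the one block open
-- at the start.
classes : ℕ → ℕ → ℕ
classes (suc n) (suc k) = total 1 n k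
classes _       _       = 0

classes-1 : ∀ n → classes (suc n) 1 ≡ 1
classes-1 zero    = refl
classes-1 (suc n) = trans (total-first 0 n 0) (trans (+-identityʳ _) (classes-1 n))

words-empty : ∀ {n k} → n < k → words n k ≡ []
words-empty {zero}  {suc k} _         = refl
words-empty {suc n} {suc k} (s≤s n<k)
  rewrite words-empty n<k | words-empty (m<n⇒m<1+n n<k) = refl

words-diagonal : ∀ n → ∃ λ w → words n n ≡ w ∷ [] × ∀ h → bound h w ≡ 0
words-diagonal zero    = [] , refl , λ _ → refl
words-diagonal (suc n) with w , e , z ← words-diagonal n =
  true ∷ w , cong₂ _++_ (cong (map (true ∷_)) e) (cong (map (false ∷_)) (words-empty (n<1+n n))) , z ∘ suc

total-diagonal : ∀ h n → total h n n ≡ 1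
total-diagonal h n with w , e , z ← words-diagonal n rewrite e | z h = refl

-- Here `d` is the excess of elements over blocks. Each step of the induction adds one summand with
-- one block fewer, and as the window of `total-last` always has length `suc k`, the corrections
-- accumulate by Pascal's rule.
classes-sum : ∀ k d → classes (suc (suc k + d)) (suc (suc k)) ≡
  sum (map (λ r → classes r (suc k)) (applyUpTo (suc k +_) (suc d))) + suc k * ((k + d) C suc (suc k))
classes-sum k zero = begin
  total 1 (suc k + 0) (suc k)
    ≡⟨ cong (λ z → total 1 z (suc k)) (+-identityʳ (suc k)) ⟩
  total 1 (suc k) (suc k)
    ≡⟨ trans (total-diagonal 1 (suc k)) (sym (total-diagonal 1 k)) ⟩
  total 1 k k
    ≡⟨ trans (+-identityʳ _) (+-identityʳ _) ⟨
  total 1 k k + 0 + 0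
    ≡⟨ cong₂ (λ x y → x + 0 + y) (cong (λ z → total 1 z k) (sym (+-identityʳ k)))
         (trans (sym (*-zeroʳ (suc k)))
           (cong (suc k *_) (sym (k>n⇒nCk≡0 (s≤s (≤-trans (≤-reflexive (+-identityʳ k)) (n≤1+n k))))))) ⟩
  total 1 (k + 0) k + 0 + suc k * ((k + 0) C suc (suc k)) ∎
  where open ≡-Reasoning
classes-sum k (suc d) = begin
  total 1 (suc k + suc d) (suc k)
    ≡⟨ cong (λ z → total 1 z (suc k)) (+-suc (suc k) d) ⟩
  total 1 (suc (suc k + d)) (suc k)
    ≡⟨ total-last 0 (suc k + d) (suc k) ⟩
  total 1 (suc k + d) (suc k) + total 1 (suc k + d) k + ((suc k + d) ⊓ (suc k + 0)) * ((k + d) C suc k)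
    ≡⟨ cong₂ (λ x y → x + total 1 (suc k + d) k + y * ((k + d) C suc k)) (classes-sum k d)
         (trans (sym (+-distribˡ-⊓ (suc k) d 0)) (trans (cong (suc k +_) (⊓-zeroʳ d)) (+-identityʳ (suc k)))) ⟩
  S + suc k * ((k + d) C suc (suc k)) + total 1 (suc k + d) k + suc k * ((k + d) C suc k)
    ≡⟨ solve 5 (λ s a b t c → s :+ a :* b :+ t :+ a :* c := s :+ (t :+ con 0) :+ a :* (c :+ b)) refl
         S (suc k) ((k + d) C suc (suc k)) (total 1 (suc k + d) k) ((k + d) C suc k) ⟩
  S + (total 1 (suc k + d) k + 0) + suc k * ((k + d) C suc k + (k + d) C suc (suc k))
    ≡⟨ cong₂ (λ x y → x + suc k * y) appended
         (trans (nCk+nC[k+1]≡[n+1]C[k+1] (k + d) (suc k)) (cong (_C suc (suc k)) (sym (+-suc k d)))) ⟩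
  sum (map F (applyUpTo (suc k +_) (suc (suc d)))) + suc k * ((k + suc d) C suc (suc k)) ∎
  where
  open ≡-Reasoning
  open +-*-Solver
  F : ℕ → ℕ
  F r = classes r (suc k)
  S : ℕ
  S = sum (map F (applyUpTo (suc k +_) (suc d)))
  appended : S + (total 1 (suc k + d) k + 0) ≡ sum (map F (applyUpTo (suc k +_) (suc (suc d))))
  appended = begin
    S + (total 1 (suc k + d) k + 0)
      ≡⟨ cong (λ z → S + (z + 0)) (cong F (sym (+-suc (suc k) d))) ⟩
    S + (F (suc k + suc d) + 0)
      ≡⟨ sum-++ (map F (applyUpTo (suc k +_) (suc d))) (F (suc k + suc d) ∷ []) ⟨
    sum (map F (applyUpTo (suc k +_) (suc d)) ++ F (suc k + suc d) ∷ [])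
      ≡⟨ cong sum (map-++ F (applyUpTo (suc k +_) (suc d)) (suc k + suc d ∷ [])) ⟨
    sum (map F (applyUpTo (suc k +_) (suc d) ++ suc k + suc d ∷ []))
      ≡⟨ cong (sum ∘ map F) (applyUpTo-∷ʳ (suc k +_) (suc d)) ⟩
    sum (map F (applyUpTo (suc k +_) (suc (suc d)))) ∎

-- Representatives

∈-extend⁺ : ∀ {b μ w} → RGS b μ w → μ ∈ extend (length w) b
∈-extend⁺ done = here refl
∈-extend⁺ {b} (old {c = c} {μ} {w} c<b r) =
  ∈-concatMap⁺ (λ c → map (c ∷_) (extend (length w) (next b c))) (lose (∈-upTo⁺ (m<n⇒m<1+n c<b))
    (∈-map⁺ (c ∷_) (subst (λ z → μ ∈ extend (length w) z) (sym (next-old c<b)) (∈-extend⁺ r))))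
∈-extend⁺ {b} (new {μ = μ} {w} r) =
  ∈-concatMap⁺ (λ c → map (c ∷_) (extend (length w) (next b c))) (lose (∈-upTo⁺ ≤-refl)
    (∈-map⁺ (b ∷_) (subst (λ z → μ ∈ extend (length w) z) (sym (next-new b)) (∈-extend⁺ r))))

∈-extend⁻ : ∀ n {b μ} → μ ∈ extend n b → ∃ λ w → RGS b μ w × length w ≡ n
∈-extend⁻ zero    (here refl) = [] , done , refl
∈-extend⁻ (suc n) {b} μ∈
  with c , c∈ , μ∈c ← find (∈-concatMap⁻ (λ c → map (c ∷_) (extend n (next b c))) {xs = upTo (suc b)} μ∈)
  with ν , ν∈ , refl ← ∈-map⁻ (c ∷_) μ∈c
  with w , r , e ← ∈-extend⁻ n ν∈
  with m<1+n⇒m<n∨m≡n (∈-upTo⁻ c∈)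
... | inj₁ c<b  = false ∷ w , old c<b (subst (λ z → RGS z ν w) (next-old c<b) r) , cong suc e
... | inj₂ refl = true ∷ w , new (subst (λ z → RGS z ν w) (next-new b) r) , cong suc e

RGS-blocks : ∀ {b μ w} → RGS b μ w → b ⊔ blocks μ ≡ b + trues w
RGS-blocks {b} done = trans (⊔-identityʳ b) (sym (+-identityʳ b))
RGS-blocks (old {μ = μ} c<b r) = trans (⊔-absorb c<b (blocks μ)) (RGS-blocks r)
RGS-blocks {b} (new {μ = μ} r) = trans (⊔-suc b (blocks μ)) (trans (RGS-blocks r) (sym (+-suc b _)))

∈-words⁺ : ∀ w → w ∈ words (length w) (trues w)
∈-words⁺ []          = here refl
∈-words⁺ (true ∷ w)  = ∈-++⁺ˡ (∈-map⁺ (true ∷_) (∈-words⁺ w))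
∈-words⁺ (false ∷ w) with trues w | ∈-words⁺ w
... | zero  | w∈ = ∈-map⁺ (false ∷_) w∈
... | suc k | w∈ = ∈-++⁺ʳ (map (true ∷_) (words (length w) k)) (∈-map⁺ (false ∷_) w∈)

∈-words⁻ : ∀ n k {w} → w ∈ words n k → length w ≡ n × trues w ≡ k
∈-words⁻ zero    zero    (here refl) = refl , refl
∈-words⁻ (suc n) zero    w∈ with _ , v∈ , refl ← ∈-map⁻ (false ∷_) w∈
                            with e , t ← ∈-words⁻ n zero v∈ = cong suc e , t
∈-words⁻ (suc n) (suc k) w∈ with ∈-++⁻ (map (true ∷_) (words n k)) w∈
... | inj₁ p with _ , v∈ , refl ← ∈-map⁻ (true ∷_) p
             with e , t ← ∈-words⁻ n k v∈ = cong suc e , cong suc t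
... | inj₂ p with _ , v∈ , refl ← ∈-map⁻ (false ∷_) p
             with e , t ← ∈-words⁻ n (suc k) v∈ = cong suc e , t

words-Unique : ∀ n k → Unique (words n k)
words-Unique zero    zero    = [] ∷ []
words-Unique zero    (suc k) = []
words-Unique (suc n) zero    = Unique.map⁺ ∷-injectiveʳ (words-Unique n zero)
words-Unique (suc n) (suc k) = Unique.++⁺
  (Unique.map⁺ ∷-injectiveʳ (words-Unique n k)) (Unique.map⁺ ∷-injectiveʳ (words-Unique n (suc k))) disjoint
  where
  disjoint : ∀ {w} → ¬ (w ∈ map (true ∷_) (words n k) × w ∈ map (false ∷_) (words n (suc k)))
  disjoint (p , q) with _ , _ , refl ← ∈-map⁻ (true ∷_) p with _ , _ , () ← ∈-map⁻ (false ∷_) q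

-- Signatures and the choice of one partition for each

signaturesOf : List Bool → List (List Bool × ℕ)
signaturesOf w = map (w ,_) (upTo (suc (bound 1 w)))

signatures : List (List Bool) → List (List Bool × ℕ)
signatures = concatMap signaturesOf

length-signatures : ∀ ws → length (signatures ws) ≡ sum (map (λ w → suc (bound 1 w)) ws)
length-signatures []       = refl
length-signatures (w ∷ ws) = trans (length-++ (signaturesOf w))
  (cong₂ _+_ (trans (length-map (w ,_) (upTo (suc (bound 1 w)))) (length-upTo (suc (bound 1 w))))
             (length-signatures ws))

∈-signatures⁺ : ∀ {w v ws} → w ∈ ws → v ≤ bound 1 w → (w , v) ∈ signatures ws
∈-signatures⁺ {w} w∈ v≤ = ∈-concatMap⁺ signaturesOf (lose w∈ (∈-map⁺ (w ,_) (∈-upTo⁺ (s≤s v≤))))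

∈-signatures⁻ : ∀ {s} ws → s ∈ signatures ws → proj₁ s ∈ ws × proj₂ s ≤ bound 1 (proj₁ s)
∈-signatures⁻ ws s∈ with w , w∈ , p ← find (∈-concatMap⁻ signaturesOf {xs = ws} s∈)
                    with v , v∈ , refl ← ∈-map⁻ (w ,_) p = w∈ , ≤-pred (∈-upTo⁻ v∈)

signatures-Unique : ∀ {ws} → Unique ws → Unique (signatures ws)
signatures-Unique [] = []
signatures-Unique {w ∷ ws} (w∉ ∷ u) = Unique.++⁺
  (Unique.map⁺ (cong proj₂) (Unique.upTo⁺ (suc (bound 1 w)))) (signatures-Unique u) disjoint
  where
  disjoint : ∀ {s} → ¬ (s ∈ signaturesOf w × s ∈ signatures ws)
  disjoint (p , q) with _ , _ , refl ← ∈-map⁻ (w ,_) p = All.lookup w∉ (proj₁ (∈-signatures⁻ ws q)) refl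

module _ {A B : Set} {P : A → B → Set} where

  choose : ∀ {xs} → All (λ x → ∃ (P x)) xs → ∃ (Pointwise P xs)
  choose []             = [] , []
  choose ((y , p) ∷ ps) with ys , qs ← choose ps = y ∷ ys , p ∷ qs

  Pointwise⇒All : ∀ {Q : B → Set} {xs ys} → (∀ {x y} → P x y → Q y) → Pointwise P xs ys → All Q ys
  Pointwise⇒All f []       = []
  Pointwise⇒All f (p ∷ ps) = f p ∷ Pointwise⇒All f ps

  Pointwise⇒AllPairs : ∀ {R : A → A → Set} {S : B → B → Set} {xs ys} →
    (∀ {x x' y y'} → P x y → P x' y' → R x x' → S y y') → Pointwise P xs ys → AllPairs R xs → AllPairs S ys
  Pointwise⇒AllPairs f [] [] = []
  Pointwise⇒AllPairs {R} {S} f (p ∷ ps) (r ∷ rs) = related r ps ∷ Pointwise⇒AllPairs f ps rs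
    where
    related : ∀ {xs ys} → All (R _) xs → Pointwise P xs ys → All (S _) ys
    related [] []               = []
    related (r ∷ rs) (q ∷ qs) = f p q r ∷ related rs qs

  Pointwise⇒Any : ∀ {Q : B → Set} {x xs ys} → (∀ {y} → P x y → Q y) → x ∈ xs → Pointwise P xs ys → Any Q ys
  Pointwise⇒Any f (here refl) (p ∷ ps) = here (f p)
  Pointwise⇒Any f (there x∈)  (p ∷ ps) = there (Pointwise⇒Any f x∈ ps)

-- The leading true of the word, for the minimum of the first block, is left
-- out of a signature.
Represents : ℕ → ℕ → List Bool × ℕ → List ℕ → Set
Represents n k (w , v) μ = w ∈ words n k × RGS 0 μ (true ∷ w) × ne μ ≡ v

represent : ∀ n k {s} → s ∈ signatures (words n k) → ∃ (Represents n k s)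
represent n k {w , v} s∈ with w∈ , v≤ ← ∈-signatures⁻ (words n k) s∈
                         with μ , r , e , _ ← realise {1} {0 ∷ []} w (s≤s z≤n) ↭-refl v≤ =
  0 ∷ μ , w∈ , new r , trans (ne≡nestings (0 ∷ μ)) e

Represents-∈ : ∀ n k {s μ} → Represents n k s μ → μ ∈ Partitions' (suc n) (suc k)
Represents-∈ n k {w , v} {μ} (w∈ , r , _) with refl , refl ← ∈-words⁻ n k w∈ =
  ∈-filter⁺ (λ μ → T? (blocks μ ≡ᵇ suc k)) (∈-extend⁺ r) (≡⇒≡ᵇ (blocks μ) (suc k) (RGS-blocks r))

represented : ∀ n k {μ} → μ ∈ Partitions' (suc n) (suc k) → ∃ λ s →
  s ∈ signatures (words n k) × Represents n k s μ
represented n k {μ} μ∈ with μ∈P , t ← ∈-filter⁻ (λ μ → T? (blocks μ ≡ᵇ suc k)) {xs = Partitions (suc n)} μ∈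
                       with true ∷ w , new {μ = ν} r , refl ← ∈-extend⁻ (suc n) {0} μ∈P
                       with refl ← suc-injective (trans (sym (RGS-blocks (new r))) (≡ᵇ⇒≡ (blocks μ) (suc k) t)) =
  (w , ne μ) ,
  ∈-signatures⁺ (∈-words⁺ w)
    (≤-trans (≤-reflexive (ne≡nestings (0 ∷ ν))) (nestings-≤-bound {1} {0 ∷ []} ↭-refl r)) ,
  ∈-words⁺ w , new r , refl

Represents-distinct : ∀ n k {s s' μ μ'} → Represents n k s μ → Represents n k s' μ' → s ≢ s' → ¬ (μ ∼ne μ')
Represents-distinct n k (w∈ , r , e) (w'∈ , r' , e') s≢s' sim =
  let l , t   = ∈-words⁻ n k w∈
      l' , t' = ∈-words⁻ n k w'∈
      e″ , w≡ = ∼ne⇒same-signature r r' (cong suc (trans l (sym l'))) (cong suc (trans t (sym t'))) sim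
  in s≢s' (cong₂ _,_ (∷-injectiveʳ w≡) (trans (sym e) (trans e″ e')))

Represents-same : ∀ n k {s μ μ'} → Represents n k s μ → Represents n k s μ' → μ ∼ne μ'
Represents-same n k (_ , r , e) (_ , r' , e') = same-signature⇒∼ne r r' (trans e (sym e'))

class-count : ∀ n k → ClassCount (suc n) (suc k) (classes (suc n) (suc k))
class-count n k =
  let reps , ps = choose (All.tabulate (represent n k)) in
  reps ,
  trans (sym (Pointwise.Pointwise-length ps)) (length-signatures (words n k)) ,
  Pointwise⇒All (Represents-∈ n k) ps ,
  Pointwise⇒AllPairs (Represents-distinct n k) ps (signatures-Unique (words-Unique n k)) ,
  λ μ μ∈ → let s , s∈ , p = represented n k μ∈ in Pointwise⇒Any (Represents-same n k p) s∈ ps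

classes-recurrence : ∀ n k → 2 ≤ k → k ≤ n → classes n k ≡
  sumFromTo (k ∸ 1) (n ∸ 1) (λ r → classes r (k ∸ 1)) + (k ∸ 1) * ((n ∸ 2) C k)
classes-recurrence n (suc (suc k)) (s≤s (s≤s z≤n)) k≤n with d , refl ← m≤n⇒∃[o]m+o≡n k≤n =
  trans (classes-sum k d)
    (cong (λ z → sum (map (λ r → classes r (suc k)) (applyUpTo (suc k +_) z)) + suc k * ((k + d) C suc (suc k)))
      (sym (trans (cong (_∸ k) (sym (+-suc k d))) (m+n∸m≡n k (suc d)))))

theorem4p6 : Σ (ℕ → ℕ → ℕ) λ f →
    (∀ n k → 1 ≤ k → k ≤ n → ClassCount n k (f n k))
    × (∀ n → 1 ≤ n → f n 1 ≡ 1)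
    × (∀ n k → 2 ≤ k → k ≤ n →
    f n k ≡ sumFromTo (k ∸ 1) (n ∸ 1) (λ r → f r (k ∸ 1)) + (k ∸ 1) * ((n ∸ 2) C k))
theorem4p6 = classes ,
  (λ { (suc n) (suc k) _ _ → class-count n k }) ,
  (λ { (suc n) _ → classes-1 n }) ,
  classes-recurrence
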